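{- Let $G$ be an arbitrary connected (finite, simple) graph of order $n\geq 3$. Then $$ s_g(G)=\begin{cases} n+2&\text{when } G\cong K_{1,3^{2q+1}-2} \text{ for some integer } q\geq 1,\\ n+1&\text{when } n\equiv 2 \pmod 4 \text{ and } G\not\cong K_{1,3^{2q+1}-2} \text{ for any integer } q\geq 1,\\ n&\text{otherwise.} \end{cases} $$
   Context: For a graph $G$ and a finite Abelian group $\mathcal{G}$ (written additively, with neutral element $0$), an edge labelling $f:E(G)\rightarrow \mathcal{G}$ determines the weighted degree $w(v)=\sum_{e\ni v} f(e)$ of each vertex $v$ (sum over all edges incident to $v$). The labelling $f$ is called $\mathcal{G}$-irregular if all weighted degrees $w(v)$, $v\in V(G)$, are pairwise distinct. The group irregularity strength $s_g(G)$ is the smallest integer $s$ such that for every Abelian group $\mathcal{G}$ of order $s$ there exists a $\mathcal{G}$-irregular labelling of $G$. $K_{1,m}$ denotes the star with $m$ leaves. -}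

module Defs where

open import Level using (0ℓ)
open import Data.Nat using (ℕ; zero; suc; _<_; _≤_)
open import Data.Fin using (Fin; zero; suc)
open import Data.Bool using (Bool; true; false; if_then_else_; _xor_)
open import Data.Product using (Σ; _×_; _,_; ∃)
open import Relation.Binary.PropositionalEquality using (_≡_)
open import Relation.Binary.Construct.Closure.ReflexiveTransitive using (Star)
open import Relation.Nullary using (¬_)
open import Function.Bundles using (_⤖_; Bijection)
open import Algebra.Bundles using (AbelianGroup)

record Graph (n : ℕ) : Set where
  field
    adj    : Fin n → Fin n → Bool
    adj-sym : ∀ i j → adj i j ≡ adj j i
    irrefl : ∀ i → adj i i ≡ false
open Graph public

Adj : ∀ {n} → Graph n → Fin n → Fin n → Set
Adj G i j = adj G i j ≡ true

Connected : ∀ {n} → Graph n → Set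
Connected G = ∀ u v → Star (Adj G) u v

_≅_ : ∀ {n k} → Graph n → Graph k → Set
_≅_ {n} {k} G H = Σ (Fin n ⤖ Fin k) λ σ →
  ∀ i j → adj H (Bijection.to σ i) (Bijection.to σ j) ≡ adj G i j

isZero : ∀ {n} → Fin n → Bool
isZero zero = true
isZero (suc _) = false

Star-graph : (m : ℕ) → Graph (suc m)
Star-graph m = record
  { adj = λ i j → isZero i xor isZero j
  ; adj-sym = sym'
  ; irrefl = irr }
  where
  sym' : ∀ (i j : Fin (suc m)) → (isZero i xor isZero j) ≡ (isZero j xor isZero i)
  sym' zero zero = _≡_.refl
  sym' zero (suc j) = _≡_.refl
  sym' (suc i) zero = _≡_.refl
  sym' (suc i) (suc j) = _≡_.refl
  irr : ∀ (i : Fin (suc m)) → (isZero i xor isZero i) ≡ false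
  irr zero = _≡_.refl
  irr (suc i) = _≡_.refl

module _ (A : AbelianGroup 0ℓ 0ℓ) where
  open AbelianGroup A

  HasOrder : ℕ → Set
  HasOrder s = Σ (Fin s → Carrier) λ e →
    (∀ i j → e i ≈ e j → i ≡ j) × (∀ x → ∃ λ i → e i ≈ x)

  sumFin : ∀ {n} → (Fin n → Carrier) → Carrier
  sumFin {zero} g = ε
  sumFin {suc n} g = g zero ∙ sumFin (λ i → g (suc i))

  -- An edge labelling: a value for each unordered pair, i.e. a symmetric function
  -- (values on non-adjacent pairs are irrelevant).
  record Labelling {n} (G : Graph n) : Set where
    field
      lab     : Fin n → Fin n → Carrier
      lab-sym : ∀ i j → lab i j ≈ lab j i
  open Labelling public

  wdeg : ∀ {n} {G : Graph n} → Labelling G → Fin n → Carrier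
  wdeg {G = G} f v = sumFin (λ u → if adj G v u then lab f v u else ε)

  Irregular : ∀ {n} {G : Graph n} → Labelling G → Set
  Irregular {n} f = ∀ (u v : Fin n) → wdeg f u ≈ wdeg f v → u ≡ v

GoodOrder : ∀ {n} → Graph n → ℕ → Set₁
GoodOrder G s = (A : AbelianGroup 0ℓ 0ℓ) → HasOrder A s →
  Σ (Labelling A G) λ f → Irregular A f

GroupIrrStrength : ∀ {n} → Graph n → ℕ → Set₁
GroupIrrStrength G k =
  1 ≤ k × GoodOrder G k × (∀ s → 1 ≤ s → s < k → ¬ GoodOrder G s)

{-# OPTIONS --safe #-}

-- Let c be a 2-colouring of G whose bichromatic edges connect G (read off a spanning tree).
-- Sending x along a bichromatic walk with alternating signs changes the weights at its ends only,
-- so a vertex weighting is a weighted degree as soon as its sums over the two colour classes agree.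
-- Hence, in a group Γ of order N, one looks for disjoint A, B ⊆ Γ with |A|, |B| the sizes of the
-- classes and ΣA = ΣB.  Pairs {d, −d} may be distributed freely, so only a small symmetric set
-- containing the 2-torsion has to be treated by hand:
--   * N = n odd: {0};
--   * N = n ≡ 0 (mod 4), unique involution ι: {0, ι, ±x} with 2x = ι;
--   * N = n ≡ 0 (mod 4), several involutions: the 2-torsion, any subset of which has the same sum
--     as its complement;
--   * N = n + 1 ≡ 3 (mod 4): {0, ±s, ±2s} with 3s ≠ 0, or {0, ±x, ±y, ±(x + y)} in exponent 3.
-- The last choice needs classes of size at least 3, which exist unless G is a star, and N is then
-- an odd power of 3.  For these stars and N = n + 2, the element 0 at the centre and two leftover
-- elements with sum ΣΓ work, unless Γ has exponent 2, which N = 4(1 + 6t), t ≥ 1, excludes.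
-- For the lower bounds, the weights sum to an element of 2Γ (fatal in ℤₙ for n ≡ 2 (mod 4)), and
-- on a star they sum to twice the weight of the centre (fatal in ℤ₃ᵏ when only one element is unused).
module Submission where

open import Defs
open import Level using (0ℓ)
open import Algebra.Bundles using (AbelianGroup)
open import Algebra.Structures using (IsAbelianGroup)
import Algebra.Construct.DirectProduct as Direct
import Algebra.Construct.Terminal as Terminal
import Algebra.Solver.CommutativeMonoid as CMSolver
open import Data.Bool using (Bool; true; false; if_then_else_; not; _∨_; _xor_)
open import Data.Bool.Properties as Bool using (not-involutive; xor-same)
open import Data.Fin using (Fin; zero; suc; toℕ; fromℕ<; combine; remQuot)
open import Data.Fin.Patterns
open import Data.Fin.Permutation using (transpose; _⟨$⟩ʳ_; ↔⇒≡)
open import Data.Fin.Properties as Fin using (_≟_; any?; toℕ<n; toℕ-fromℕ<; toℕ-injective)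
open import Data.List using (List; []; _∷_; _++_; [_]; length; map; allFin; foldr; tabulate; filter; lookup; take; drop; deduplicate)
open import Data.List.Membership.Propositional using (_∈_; _∉_)
open import Data.List.Membership.Propositional.Properties
  using (∈-∃++; ∈-allFin; ∈-filter⁺; ∈-filter⁻; ∈-++⁺ˡ; ∈-++⁺ʳ; ∈-map⁺; ∈-lookup; ∈-tabulate⁺)
open import Data.List.Membership.Propositional.Properties.WithK using (unique∧set⇒bag)
open import Data.List.Properties
  using (length-tabulate; length-++; take++drop≡id; length-take; length-drop; ++-identityʳ; ++-assoc)
open import Data.List.Relation.Binary.BagAndSetEquality using (∼bag⇒↭)
open import Data.List.Relation.Binary.Permutation.Propositional
  using (_↭_; ↭-refl; ↭-sym; ↭-trans; ↭-reflexive; ↭⇒↭ₛ; prep)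
open import Data.List.Relation.Binary.Permutation.Propositional.Properties
  using (↭-length; ∈-resp-↭; shift; shifts; ++⁺ˡ; ++-commutativeMonoid)
import Data.List.Relation.Binary.Permutation.Setoid.Properties as PermSetoid
open import Data.List.Relation.Unary.All as All using ([]; _∷_)
open import Data.List.Relation.Unary.AllPairs using (AllPairs; []; _∷_)
open import Data.List.Relation.Unary.Any as Any using (here; there)
open import Data.List.Relation.Unary.Any.Properties as Anyₚ using (lookup-index)
open import Data.List.Relation.Unary.Unique.DecSetoid.Properties using (deduplicate-!)
open import Data.List.Relation.Unary.Unique.Propositional using (Unique)
open import Data.List.Relation.Unary.Unique.Propositional.Properties
  using (allFin⁺; filter⁺; map⁺; tabulate⁺; ++⁺; Unique[x∷xs]⇒x∉xs)
open import Data.Nat using (ℕ; zero; suc; _+_; _*_; _∸_; _^_; _≤_; _<_; _%_; _/_; z≤n; s≤s; _≤?_; NonZero)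
open import Data.Nat.DivMod
  using (m≡m%n+[m/n]*n; [m+kn]%n≡m%n; %-distribˡ-+; m%n%n≡m%n; m%n<n; n%n≡0; m*n%n≡0; m<n⇒m%n≡m)
open import Data.Nat.Induction using (<-rec)
import Data.Nat.Properties as ℕₚ
open import Data.Nat.Tactic.RingSolver using (solve-∀)
open import Data.Product using (Σ; _×_; _,_; ∃; proj₁; proj₂)
open import Data.Sum using (_⊎_; inj₁; inj₂)
open import Data.Vec as Vec using (Vec; []; _∷_; replicate; zipWith)
open import Function using (_∘_; id)
open import Function.Bundles using (Bijection; mk⇔)
open import Function.Properties.Bijection using (⤖⇒↔)
open import Function.Properties.Inverse using (↔⇒⤖)
open import Relation.Binary using (DecSetoid)
open import Relation.Binary.Construct.Closure.ReflexiveTransitive as Walk using (Star; _◅_; _◅◅_)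
open import Relation.Binary.PropositionalEquality as ≡ using (_≡_; _≢_; refl; sym; trans; cong; cong₂; subst)
open import Relation.Nullary using (¬_; Dec; yes; no; does; ¬?; contradiction)
open import Relation.Nullary.Decidable using (_×-dec_; decidable-stable; dec-true; dec-false)

-- A decision procedure for linear identities in Abelian groups

-- A term denotes Σ pos e i · xᵢ − Σ neg e i · xᵢ; two terms are equal in every Abelian group when
-- these multiplicities agree after moving the negative ones across.

infixl 6 _:+_
infix 7 :-_

data Expr (n : ℕ) : Set where
  var  : Fin n → Expr n
  :0   : Expr n
  _:+_ : Expr n → Expr n → Expr n
  :-_  : Expr n → Expr n

unit : ∀ {n} → Fin n → Vec ℕ n
unit zero    = 1 ∷ replicate _ 0
unit (suc i) = 0 ∷ unit i

pos neg : ∀ {n} → Expr n → Vec ℕ n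
pos (var i)   = unit i
pos :0        = replicate _ 0
pos (a :+ b)  = zipWith _+_ (pos a) (pos b)
pos (:- a)    = neg a
neg (var i)   = replicate _ 0
neg :0        = replicate _ 0
neg (a :+ b)  = zipWith _+_ (neg a) (neg b)
neg (:- a)    = pos a

module AbelianSolver (A : AbelianGroup 0ℓ 0ℓ) where
  open AbelianGroup A renaming (refl to ≈-refl; sym to ≈-sym; trans to ≈-trans)
  open import Algebra.Properties.Monoid.Mult monoid using (×-homo-+) renaming (_×_ to _·_)
  open import Algebra.Properties.Group group using (∙-cancelʳ)
  open import Algebra.Properties.CommutativeSemigroup commutativeSemigroup using (interchange)
  open import Relation.Binary.Reasoning.Setoid setoid

  ⟦_⟧ : ∀ {n} → Expr n → Vec Carrier n → Carrier
  ⟦ var i ⟧ ρ  = Vec.lookup ρ i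
  ⟦ :0 ⟧ ρ     = ε
  ⟦ a :+ b ⟧ ρ = ⟦ a ⟧ ρ ∙ ⟦ b ⟧ ρ
  ⟦ :- a ⟧ ρ   = ⟦ a ⟧ ρ ⁻¹

  lin : ∀ {n} → Vec ℕ n → Vec Carrier n → Carrier
  lin []       []      = ε
  lin (k ∷ ks) (x ∷ ρ) = k · x ∙ lin ks ρ

  lin-0 : ∀ {n} (ρ : Vec Carrier n) → lin (replicate _ 0) ρ ≈ ε
  lin-0 []      = ≈-refl
  lin-0 (x ∷ ρ) = ≈-trans (identityˡ _) (lin-0 ρ)

  lin-unit : ∀ {n} (i : Fin n) ρ → lin (unit i) ρ ≈ Vec.lookup ρ i
  lin-unit zero    (x ∷ ρ) = ≈-trans (∙-cong (identityʳ x) (lin-0 ρ)) (identityʳ x)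
  lin-unit (suc i) (x ∷ ρ) = ≈-trans (identityˡ _) (lin-unit i ρ)

  lin-+ : ∀ {n} (u v : Vec ℕ n) ρ → lin (zipWith _+_ u v) ρ ≈ lin u ρ ∙ lin v ρ
  lin-+ []      []      []      = ≈-sym (identityˡ ε)
  lin-+ (j ∷ u) (k ∷ v) (x ∷ ρ) =
    ≈-trans (∙-cong (×-homo-+ x j k) (lin-+ u v ρ)) (interchange _ _ _ _)

  pos-neg : ∀ {n} (e : Expr n) ρ → ⟦ e ⟧ ρ ∙ lin (neg e) ρ ≈ lin (pos e) ρ
  pos-neg (var i) ρ = ≈-trans (∙-congˡ (lin-0 ρ)) (≈-trans (identityʳ _) (≈-sym (lin-unit i ρ)))
  pos-neg :0 ρ = identityˡ _
  pos-neg (a :+ b) ρ = begin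
    ⟦ a ⟧ ρ ∙ ⟦ b ⟧ ρ ∙ lin (zipWith _+_ (neg a) (neg b)) ρ
      ≈⟨ ∙-congˡ (lin-+ (neg a) (neg b) ρ) ⟩
    ⟦ a ⟧ ρ ∙ ⟦ b ⟧ ρ ∙ (lin (neg a) ρ ∙ lin (neg b) ρ)
      ≈⟨ interchange _ _ _ _ ⟩
    ⟦ a ⟧ ρ ∙ lin (neg a) ρ ∙ (⟦ b ⟧ ρ ∙ lin (neg b) ρ)
      ≈⟨ ∙-cong (pos-neg a ρ) (pos-neg b ρ) ⟩
    lin (pos a) ρ ∙ lin (pos b) ρ
      ≈⟨ lin-+ (pos a) (pos b) ρ ⟨
    lin (zipWith _+_ (pos a) (pos b)) ρ ∎
  pos-neg (:- a) ρ = begin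
    ⟦ a ⟧ ρ ⁻¹ ∙ lin (pos a) ρ                 ≈⟨ ∙-congˡ (pos-neg a ρ) ⟨
    ⟦ a ⟧ ρ ⁻¹ ∙ (⟦ a ⟧ ρ ∙ lin (neg a) ρ)     ≈⟨ assoc _ _ _ ⟨
    ⟦ a ⟧ ρ ⁻¹ ∙ ⟦ a ⟧ ρ ∙ lin (neg a) ρ       ≈⟨ ∙-congʳ (inverseˡ _) ⟩
    ε ∙ lin (neg a) ρ                          ≈⟨ identityˡ _ ⟩
    lin (neg a) ρ ∎

  -- Adding the negative parts of both terms to either side gives the same natural linear
  -- combination, so cancellation finishes. For concrete terms the hypothesis is an equation between
  -- numeral vectors, closed by `refl`.
  solve : ∀ {n} (a b : Expr n) → zipWith _+_ (pos a) (neg b) ≡ zipWith _+_ (pos b) (neg a) →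
          ∀ ρ → ⟦ a ⟧ ρ ≈ ⟦ b ⟧ ρ
  solve a b eq ρ = ∙-cancelʳ (lin (neg a) ρ ∙ lin (neg b) ρ) _ _ (begin
    ⟦ a ⟧ ρ ∙ (lin (neg a) ρ ∙ lin (neg b) ρ) ≈⟨ assoc _ _ _ ⟨
    ⟦ a ⟧ ρ ∙ lin (neg a) ρ ∙ lin (neg b) ρ   ≈⟨ ∙-congʳ (pos-neg a ρ) ⟩
    lin (pos a) ρ ∙ lin (neg b) ρ             ≈⟨ lin-+ (pos a) (neg b) ρ ⟨
    lin (zipWith _+_ (pos a) (neg b)) ρ       ≡⟨ cong (λ v → lin v ρ) eq ⟩
    lin (zipWith _+_ (pos b) (neg a)) ρ       ≈⟨ lin-+ (pos b) (neg a) ρ ⟩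
    lin (pos b) ρ ∙ lin (neg a) ρ             ≈⟨ ∙-congʳ (pos-neg b ρ) ⟨
    ⟦ b ⟧ ρ ∙ lin (neg b) ρ ∙ lin (neg a) ρ   ≈⟨ assoc _ _ _ ⟩
    ⟦ b ⟧ ρ ∙ (lin (neg b) ρ ∙ lin (neg a) ρ) ≈⟨ ∙-congˡ (comm _ _) ⟩
    ⟦ b ⟧ ρ ∙ (lin (neg a) ρ ∙ lin (neg b) ρ) ∎)

-- Finite Abelian groups

-- Carrier `Fin N` with propositional equality makes membership and existence decidable, so
-- witnesses can be searched for with `any?`. `Transport` brings every group of order N into this
-- form.
record FinAb (N : ℕ) : Set where
  infixl 6 _⊕_
  infix 7 ⊖_
  field
    _⊕_ : Fin N → Fin N → Fin N
    0#  : Fin N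
    ⊖_  : Fin N → Fin N
    isAbelianGroup : IsAbelianGroup _≡_ _⊕_ 0# ⊖_
  abelianGroup : AbelianGroup 0ℓ 0ℓ
  abelianGroup = record { isAbelianGroup = isAbelianGroup }

module Transport (A : AbelianGroup 0ℓ 0ℓ) {N} (ord : HasOrder A N) where
  open AbelianGroup A renaming (refl to ≈-refl; sym to ≈-sym; trans to ≈-trans)

  enum : Fin N → Carrier
  enum = proj₁ ord

  enum-inj : ∀ i j → enum i ≈ enum j → i ≡ j
  enum-inj = proj₁ (proj₂ ord)

  index : Carrier → Fin N
  index x = proj₁ (proj₂ (proj₂ ord) x)

  enum-index : ∀ x → enum (index x) ≈ x
  enum-index x = proj₂ (proj₂ (proj₂ ord) x)

  index-cong : ∀ {x y} → x ≈ y → index x ≡ index y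
  index-cong p = enum-inj _ _ (≈-trans (enum-index _) (≈-trans p (≈-sym (enum-index _))))

  index-enum : ∀ i → index (enum i) ≡ i
  index-enum i = enum-inj _ _ (enum-index _)

  index-inj : ∀ {x y} → index x ≡ index y → x ≈ y
  index-inj p = ≈-trans (≈-sym (enum-index _)) (≈-trans (reflexive (cong enum p)) (enum-index _))

  finAb : FinAb N
  finAb = record
    { _⊕_ = λ i j → index (enum i ∙ enum j)
    ; 0#  = index ε
    ; ⊖_  = λ i → index (enum i ⁻¹)
    ; isAbelianGroup = record
      { isGroup = record
        { isMonoid = record
          { isSemigroup = record
            { isMagma = record { isEquivalence = ≡.isEquivalence ; ∙-cong = λ { refl refl → refl } }
            ; assoc = λ i j k → index-cong
                (≈-trans (∙-congʳ (enum-index _)) (≈-trans (assoc _ _ _) (∙-congˡ (≈-sym (enum-index _)))))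
            }
          ; identity = (λ i → trans (index-cong (≈-trans (∙-congʳ (enum-index _)) (identityˡ _))) (index-enum i))
                     , (λ i → trans (index-cong (≈-trans (∙-congˡ (enum-index _)) (identityʳ _))) (index-enum i))
          }
        ; inverse = (λ i → index-cong (≈-trans (∙-congʳ (enum-index _)) (inverseˡ _)))
                  , (λ i → index-cong (≈-trans (∙-congˡ (enum-index _)) (inverseʳ _)))
        ; ⁻¹-cong = λ { refl → refl }
        }
      ; comm = λ i j → index-cong (comm _ _)
      }
    }

  open FinAb finAb using (_⊕_; 0#)

  index-∙ : ∀ x y → index (x ∙ y) ≡ index x ⊕ index y
  index-∙ x y = index-cong (≈-sym (∙-cong (enum-index x) (enum-index y)))

  enum-sumFin : ∀ {n} (g : Fin n → Fin N) →
    sumFin A (λ i → enum (g i)) ≈ enum (sumFin (FinAb.abelianGroup finAb) g)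
  enum-sumFin {zero}  g = ≈-sym (enum-index ε)
  enum-sumFin {suc n} g = ≈-trans (∙-congˡ (enum-sumFin (λ i → g (suc i)))) (≈-sym (enum-index _))

  sumFin-cong : ∀ {n} {f g : Fin n → Carrier} → (∀ i → f i ≈ g i) → sumFin A f ≈ sumFin A g
  sumFin-cong {zero}  p = ≈-refl
  sumFin-cong {suc n} p = ∙-cong (p zero) (sumFin-cong (λ i → p (suc i)))

  module _ {n} {G : Graph n} (f : Labelling (FinAb.abelianGroup finAb) G) where

    enumLabelling : Labelling A G
    enumLabelling = record
      { lab     = λ i j → enum (Labelling.lab f i j)
      ; lab-sym = λ i j → reflexive (cong enum (Labelling.lab-sym f i j)) }

    enum-wdeg : ∀ v → wdeg A enumLabelling v ≈ enum (wdeg (FinAb.abelianGroup finAb) f v)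
    enum-wdeg v = ≈-trans (sumFin-cong push) (enum-sumFin (λ u → if adj G v u then Labelling.lab f v u else 0#))
      where
      push : ∀ u → (if adj G v u then enum (Labelling.lab f v u) else ε)
                 ≈ enum (if adj G v u then Labelling.lab f v u else 0#)
      push u with adj G v u
      ... | true  = ≈-refl
      ... | false = ≈-sym (enum-index ε)

-- The enumeration is an isomorphism, so it carries labels and weighted degrees over together, and
-- injectivity keeps the weights distinct.
goodOrder-fromFinAb : ∀ {n} {G : Graph n} {N} →
  ((Γ : FinAb N) → Σ (Labelling (FinAb.abelianGroup Γ) G) (Irregular (FinAb.abelianGroup Γ))) →
  GoodOrder G N
goodOrder-fromFinAb H A ord =
  let f , irr = H finAb in
  enumLabelling f , λ u v p → irr u v
    (enum-inj _ _ (≈-trans (≈-sym (enum-wdeg f u)) (≈-trans p (enum-wdeg f v))))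
  where
  open AbelianGroup A renaming (refl to ≈-refl; sym to ≈-sym; trans to ≈-trans)
  open Transport A ord

-- Lists of group elements

module _ {X : Set} where

  unique-↭ : {xs ys : List X} → Unique xs → Unique ys →
             (∀ {x} → x ∈ xs → x ∈ ys) → (∀ {x} → x ∈ ys → x ∈ xs) → xs ↭ ys
  unique-↭ u v f g = ∼bag⇒↭ (unique∧set⇒bag u v (mk⇔ f g))

  Unique-resp-↭ : {xs ys : List X} → xs ↭ ys → Unique xs → Unique ys
  Unique-resp-↭ p = PermSetoid.Unique-resp-↭ (≡.setoid X) (↭⇒↭ₛ p)

  flat : (X → X) → List X → List X
  flat φ []      = []
  flat φ (d ∷ D) = d ∷ φ d ∷ flat φ D

  flat-++ : ∀ φ D E → flat φ (D ++ E) ≡ flat φ D ++ flat φ E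
  flat-++ φ []      E = refl
  flat-++ φ (d ∷ D) E = cong (λ l → d ∷ φ d ∷ l) (flat-++ φ D E)

  length-flat : ∀ φ D → length (flat φ D) ≡ 2 * length D
  length-flat φ []      = refl
  length-flat φ (d ∷ D) rewrite length-flat φ D = sym (ℕₚ.*-suc 2 (length D))

  -- Remove x together with φ x: what remains is again closed under the fixed-point-free involution
  -- φ. The recursion runs on a bound for the length, since the remainder is not a sublist by
  -- structure.
  pairUp : ∀ (φ : X → X) (L : List X) → Unique L →
    (∀ {x} → x ∈ L → φ x ∈ L) → (∀ {x} → x ∈ L → φ (φ x) ≡ x) → (∀ {x} → x ∈ L → φ x ≢ x) →
    ∃ λ D → L ↭ flat φ D
  pairUp φ L = go (length L) L ℕₚ.≤-refl
    where
    go : ∀ k L → length L ≤ k → Unique L →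
      (∀ {x} → x ∈ L → φ x ∈ L) → (∀ {x} → x ∈ L → φ (φ x) ≡ x) → (∀ {x} → x ∈ L → φ x ≢ x) →
      ∃ λ D → L ↭ flat φ D
    go k       []      _ _ _ _ _ = [] , ↭-refl
    go (suc k) (x ∷ L) (s≤s len) uniq closed invol free with closed (here refl)
    ... | here φx≡x = contradiction φx≡x (free (here refl))
    ... | there φx∈L =
      let ys , zs , L≡ = ∈-∃++ φx∈L
          L↭ : L ↭ φ x ∷ ys ++ zs
          L↭ = ↭-trans (subst (λ l → L ↭ l) L≡ ↭-refl) (shift (φ x) ys zs)
          M = ys ++ zs
          p : x ∷ L ↭ x ∷ φ x ∷ M
          p = prep x L↭
          uniq′ : Unique (x ∷ φ x ∷ M)
          uniq′ = Unique-resp-↭ p uniq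
          uniqM : Unique M
          uniqM = tail′ (tail′ uniq′)
          old : ∀ {y} → y ∈ M → y ∈ x ∷ L
          old y∈ = ∈-resp-↭ (↭-sym p) (there (there y∈))
          closedM : ∀ {y} → y ∈ M → φ y ∈ M
          closedM y∈ = notHead y∈ uniq′ (∈-resp-↭ p (closed (old y∈))) (invol (old y∈)) (invol (here refl))
          D , q = go k M (short (↭-length L↭) len) uniqM closedM (invol ∘ old) (free ∘ old)
      in x ∷ D , ↭-trans p (prep x (prep (φ x) q))
      where
      tail′ : ∀ {y} {l : List X} → Unique (y ∷ l) → Unique l
      tail′ (_ ∷ u) = u
      short : ∀ {m l} → l ≡ suc m → l ≤ k → m ≤ k
      short refl l≤k = ℕₚ.≤-trans (ℕₚ.n≤1+n _) l≤k
      notHead : ∀ {y M} → y ∈ M → Unique (x ∷ φ x ∷ M) → φ y ∈ x ∷ φ x ∷ M →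
                φ (φ y) ≡ y → φ (φ x) ≡ x → φ y ∈ M
      notHead {y} y∈ (_ ∷ u′) (here φy≡x) iy ix =
        contradiction (subst (_∈ _) (trans (sym iy) (cong φ φy≡x)) y∈) (Unique[x∷xs]⇒x∉xs u′)
      notHead {y} y∈ u (there (here φy≡φx)) iy ix =
        contradiction (there (subst (_∈ _) (trans (sym iy) (trans (cong φ φy≡φx) ix)) y∈)) (Unique[x∷xs]⇒x∉xs u)
      notHead y∈ u (there (there φy∈)) _ _ = φy∈

module _ {N : ℕ} where
  open import Data.List.Membership.DecPropositional (Fin._≟_ {N}) using (_∈?_)

  complement : ∀ {S : List (Fin N)} → Unique S →
    ∃ λ R → (allFin N ↭ S ++ R) × Unique R × (∀ {x} → x ∈ R → x ∉ S) × (∀ {x} → x ∉ S → x ∈ R)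
  complement {S} uniq = R , unique-↭ (allFin⁺ N) (++⁺ uniq uR disj) (λ {x} _ → inside x) (λ {x} _ → ∈-allFin x)
                       , uR , out , (λ {x} x∉ → ∈-filter⁺ out? (∈-allFin x) x∉)
    where
    out? = λ x → ¬? (x ∈? S)
    R = filter out? (allFin N)
    uR : Unique R
    uR = filter⁺ out? (allFin⁺ N)
    out : ∀ {x} → x ∈ R → x ∉ S
    out x∈ = proj₂ (∈-filter⁻ out? {xs = allFin N} x∈)
    disj : ∀ {x} → ¬ (x ∈ S × x ∈ R)
    disj (x∈S , x∈R) = out x∈R x∈S
    inside : ∀ x → x ∈ S ++ R
    inside x with x ∈? S
    ... | yes x∈ = ∈-++⁺ˡ x∈
    ... | no x∉  = ∈-++⁺ʳ S (∈-filter⁺ out? (∈-allFin x) x∉)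

  length-allFin-↭ : ∀ {L : List (Fin N)} → allFin N ↭ L → length L ≡ N
  length-allFin-↭ p = trans (sym (↭-length p)) (length-tabulate {n = N} (λ i → i))

  -- Pigeonhole: if L contained everything, taking positions in L would inject `Fin N` into a
  -- smaller set.
  fresh : ∀ (L : List (Fin N)) → length L < N → ∃ λ x → x ∉ L
  fresh L short with any? (λ x → ¬? (x ∈? L))
  ... | yes found = found
  ... | no none = contradiction (Fin.injective⇒≤ {f = λ x → Any.index (inL x)} inj) (ℕₚ.<⇒≱ short)
    where
    inL : ∀ x → x ∈ L
    inL x = decidable-stable (x ∈? L) (λ x∉ → none (x , x∉))
    inj : ∀ {x y} → Any.index (inL x) ≡ Any.index (inL y) → x ≡ y
    inj {x} {y} eq = trans (lookup-index (inL x)) (trans (cong (lookup L) eq) (sym (lookup-index (inL y))))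

-- Balanced splittings

module Balance {N : ℕ} (Γ : FinAb N) where
  open FinAb Γ public
  open AbelianGroup abelianGroup public
    using (assoc; comm; identityˡ; identityʳ; inverseˡ; inverseʳ; isCommutativeMonoid; group)
  open import Algebra.Properties.Group group public
    using (⁻¹-involutive; ⁻¹-injective; ε⁻¹≈ε; x∙y⁻¹≈ε⇒x≈y; x≈y⇒x∙y⁻¹≈ε; ∙-cancelˡ; inverseˡ-unique)
  open AbelianSolver abelianGroup public using (solve; ⟦_⟧)

  -- x = y follows from l = r as soon as x − y and l − r are formally equal.
  deduce : ∀ {n} (x y l r : Expr n) →
    zipWith _+_ (pos (x :+ (:- y))) (neg (l :+ (:- r))) ≡ zipWith _+_ (pos (l :+ (:- r))) (neg (x :+ (:- y))) →
    ∀ ρ → ⟦ l ⟧ ρ ≡ ⟦ r ⟧ ρ → ⟦ x ⟧ ρ ≡ ⟦ y ⟧ ρ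
  deduce x y l r eq ρ l≡r =
    x∙y⁻¹≈ε⇒x≈y _ _ (trans (solve (x :+ (:- y)) (l :+ (:- r)) eq ρ) (x≈y⇒x∙y⁻¹≈ε l≡r))

  ∑ : List (Fin N) → Fin N
  ∑ = foldr _⊕_ 0#

  ∑-++ : ∀ xs ys → ∑ (xs ++ ys) ≡ ∑ xs ⊕ ∑ ys
  ∑-++ []       ys = sym (identityˡ _)
  ∑-++ (x ∷ xs) ys = trans (cong (x ⊕_) (∑-++ xs ys)) (sym (assoc _ _ _))

  ∑-↭ : ∀ {xs ys} → xs ↭ ys → ∑ xs ≡ ∑ ys
  ∑-↭ p = PermSetoid.foldr-commMonoid (≡.setoid _) isCommutativeMonoid (↭⇒↭ₛ p)

  ∑-flat-⊖ : ∀ D → ∑ (flat ⊖_ D) ≡ 0#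
  ∑-flat-⊖ []      = refl
  ∑-flat-⊖ (d ∷ D) rewrite ∑-flat-⊖ D =
    solve (var 0F :+ (:- var 0F :+ :0)) :0 refl (d ∷ [])

  ∑-map-⊖ : ∀ xs → ∑ (map ⊖_ xs) ≡ ⊖ ∑ xs
  ∑-map-⊖ []       = sym ε⁻¹≈ε
  ∑-map-⊖ (x ∷ xs) rewrite ∑-map-⊖ xs =
    solve (:- var 0F :+ :- var 1F) (:- (var 0F :+ var 1F)) refl (x ∷ ∑ xs ∷ [])

  σ : Fin N
  σ = ∑ (allFin N)

  -- Negation permutes the group, so σ = -σ.
  σ⊕σ : σ ⊕ σ ≡ 0#
  σ⊕σ = deduce (var 0F :+ var 0F) :0 (var 0F) (:- var 0F) refl (σ ∷ [])
    (trans (∑-↭ negate) (∑-map-⊖ (allFin N)))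
    where
    negate : allFin N ↭ map ⊖_ (allFin N)
    negate = unique-↭ (allFin⁺ N) (map⁺ ⁻¹-injective (allFin⁺ N))
      (λ {x} _ → subst (_∈ map ⊖_ (allFin N)) (⁻¹-involutive x) (∈-map⁺ ⊖_ (∈-allFin (⊖ x))))
      (λ {x} _ → ∈-allFin x)

  -- `As` and `Bs` will be the weights on the two colour classes, `Rs` the elements left over.
  -- Disjointness is implicit in `covers`, because `allFin N` has no repetitions.
  record Split (a b : ℕ) : Set where
    field
      As Bs Rs : List (Fin N)
      length-A : length As ≡ a
      length-B : length Bs ≡ b
      covers   : allFin N ↭ As ++ Bs ++ Rs
      balanced : ∑ As ≡ ∑ Bs

  Split-sym : ∀ {a b} → Split a b → Split b a
  Split-sym s = record
    { As = Bs ; Bs = As ; Rs = Rs ; length-A = length-B ; length-B = length-A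
    ; covers = ↭-trans covers (shifts As Bs)
    ; balanced = sym balanced }
    where open Split s

  -- Containing the 2-torsion is what makes negation fixed-point-free outside S, so that the
  -- complement falls into pairs {d, -d}.
  record Symmetric (S : List (Fin N)) : Set where
    field
      unique  : Unique S
      closed  : ∀ {x} → x ∈ S → ⊖ x ∈ S
      torsion : ∀ {x} → x ⊕ x ≡ 0# → x ∈ S

  ⊖x≡x⇒x⊕x≡0 : ∀ {x} → ⊖ x ≡ x → x ⊕ x ≡ 0#
  ⊖x≡x⇒x⊕x≡0 {x} = deduce (var 0F :+ var 0F) :0 (:- (:- var 0F)) (:- var 0F) refl (x ∷ []) ∘ cong ⊖_

  x⊕x≡0⇒⊖x≡x : ∀ {x} → x ⊕ x ≡ 0# → ⊖ x ≡ x
  x⊕x≡0⇒⊖x≡x {x} eq = sym (inverseˡ-unique x x eq)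

  Symmetric-∷ : ∀ {S x} → Symmetric S → x ∉ S → Symmetric (x ∷ ⊖ x ∷ S)
  Symmetric-∷ {S} {x} sy x∉ = record
    { unique  = (x≢⊖x ∷ All.tabulate (λ y∈ x≡y → x∉ (subst (_∈ S) (sym x≡y) y∈)))
              ∷ All.tabulate (λ y∈ ⊖x≡y → ⊖x∉ (subst (_∈ S) (sym ⊖x≡y) y∈))
              ∷ unique
    ; closed  = λ { (here refl) → there (here refl)
                  ; (there (here refl)) → here (⁻¹-involutive x)
                  ; (there (there y∈)) → there (there (closed y∈)) }
    ; torsion = λ t → there (there (torsion t)) }
    where
    open Symmetric sy
    ⊖x∉ : ⊖ x ∉ S
    ⊖x∉ ⊖x∈ = x∉ (subst (_∈ S) (⁻¹-involutive x) (closed ⊖x∈))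
    x≢⊖x : x ≢ ⊖ x
    x≢⊖x eq = x∉ (torsion (⊖x≡x⇒x⊕x≡0 (sym eq)))

  Symmetric-pairs : ∀ {S} → Symmetric S → ∃ λ D → allFin N ↭ S ++ flat ⊖_ D
  Symmetric-pairs {S} sy =
    let R , cover , uR , out , into = complement unique
        D , p = pairUp ⊖_ R uR
          (λ {x} x∈R → into (λ ⊖x∈S → out x∈R (subst (_∈ S) (⁻¹-involutive x) (closed ⊖x∈S))))
          (λ {x} _ → ⁻¹-involutive x)
          (λ x∈R ⊖x≡x → out x∈R (torsion (⊖x≡x⇒x⊕x≡0 ⊖x≡x)))
    in D , ↭-trans cover (++⁺ˡ S p)
    where open Symmetric sy

  Symmetric-length : ∀ S D → allFin N ↭ S ++ flat ⊖_ D → length S + 2 * length D ≡ N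
  Symmetric-length S D p = trans (cong (length S +_) (sym (length-flat ⊖_ D)))
    (trans (sym (length-++ S)) (length-allFin-↭ p))

  private
    gather : ∀ SA SB SR F₁ F₂ → (SA ++ SB ++ SR) ++ (F₁ ++ F₂) ↭ (SA ++ F₁) ++ (SB ++ F₂) ++ SR
    gather = λ SA SB SR F₁ F₂ → solve′ 5 (λ a b r f g → (a ⊹ (b ⊹ r)) ⊹ (f ⊹ g) ⊜ (a ⊹ f) ⊹ ((b ⊹ g) ⊹ r)) ↭-refl SA SB SR F₁ F₂
      where open CMSolver (++-commutativeMonoid {A = Fin N}) using (_⊜_) renaming (_⊕_ to _⊹_; solve to solve′)

  -- Distributing the pairs {d, −d} does not change the sums of the two parts.
  Split-pairs : ∀ {a b} SA SB SR → Symmetric (SA ++ SB ++ SR) → ∑ SA ≡ ∑ SB →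
    ∀ i j → a ≡ length SA + 2 * i → b ≡ length SB + 2 * j → a + b + length SR ≡ N → Split a b
  Split-pairs {a} {b} SA SB SR sy bal i j refl refl total = record
    { As = SA ++ F₁ ; Bs = SB ++ F₂ ; Rs = SR
    ; length-A = trans (length-++ SA) (cong (length SA +_) (trans (length-flat ⊖_ D₁) (cong (2 *_) lenD₁)))
    ; length-B = trans (length-++ SB) (cong (length SB +_) (trans (length-flat ⊖_ D₂) (cong (2 *_) lenD₂)))
    ; covers   = ↭-trans cover (↭-trans
        (↭-reflexive (cong ((SA ++ SB ++ SR) ++_) (trans (cong (flat ⊖_) (sym (take++drop≡id i D))) (flat-++ ⊖_ D₁ D₂))))
        (gather SA SB SR F₁ F₂))
    ; balanced = trans (∑+pairs SA D₁) (trans bal (sym (∑+pairs SB D₂))) }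
    where
    D = proj₁ (Symmetric-pairs sy)
    cover = proj₂ (Symmetric-pairs sy)
    D₁ = take i D
    D₂ = drop i D
    F₁ = flat ⊖_ D₁
    F₂ = flat ⊖_ D₂
    ∑+pairs : ∀ S E → ∑ (S ++ flat ⊖_ E) ≡ ∑ S
    ∑+pairs S E = trans (∑-++ S _) (trans (cong (∑ S ⊕_) (∑-flat-⊖ E)) (identityʳ _))
    p = length SA
    q = length SB
    r = length SR
    lenS : length (SA ++ SB ++ SR) ≡ p + (q + r)
    lenS = trans (length-++ SA) (cong (p +_) (length-++ SB))
    -- Comparing total sizes: the pairs requested by the two parts are exactly all the pairs
    -- available.
    count : i + j ≡ length D
    count = ℕₚ.*-cancelˡ-≡ _ _ 2 (ℕₚ.+-cancelˡ-≡ (p + (q + r)) _ _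
      (trans (rearr p q r i j) (trans total (sym (trans (cong (_+ 2 * length D) (sym lenS)) (Symmetric-length (SA ++ SB ++ SR) D cover))))))
      where
      rearr : ∀ p q r i j → (p + (q + r)) + 2 * (i + j) ≡ (p + 2 * i) + (q + 2 * j) + r
      rearr = solve-∀
    lenD₁ : length D₁ ≡ i
    lenD₁ = trans (length-take i D) (ℕₚ.m≤n⇒m⊓n≡m (subst (i ≤_) count (ℕₚ.m≤m+n i j)))
    lenD₂ : length D₂ ≡ j
    lenD₂ = trans (length-drop i D) (trans (cong (_∸ i) (sym count)) (ℕₚ.m+n∸m≡n i j))

-- Quotients and groups of exponent 2 and 3

lookup-AllPairs-injective : ∀ {X : Set} {R : X → X → Set} → (∀ {x y} → R x y → R y x) → ∀ {xs} → AllPairs (λ x y → ¬ R x y) xs →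
  ∀ i j → R (lookup xs i) (lookup xs j) → i ≡ j
lookup-AllPairs-injective s (_ ∷ _) zero zero _ = refl
lookup-AllPairs-injective s (p ∷ _) zero (suc j) r = contradiction r (All.lookup p (∈-lookup j))
lookup-AllPairs-injective s (p ∷ _) (suc i) zero r = contradiction (s r) (All.lookup p (∈-lookup i))
lookup-AllPairs-injective s (_ ∷ ps) (suc i) (suc j) r = cong suc (lookup-AllPairs-injective s ps i j r)

record Subgroup {N} (Γ : FinAb N) (H : List (Fin N)) : Set where
  open FinAb Γ
  field
    unique : Unique H
    0∈     : 0# ∈ H
    minus  : ∀ {x y} → x ∈ H → y ∈ H → x ⊕ ⊖ y ∈ H

record Quotient {N} (Γ : FinAb N) (H : List (Fin N)) : Set where
  module Γ = FinAb Γ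
  field
    {M}      : ℕ
    Γ′       : FinAb M
  module Γ′ = FinAb Γ′
  field
    order    : N ≡ M * length H
    π        : Fin N → Fin M
    π-⊕      : ∀ x y → π (x Γ.⊕ y) ≡ π x Γ′.⊕ π y
    π-0      : π Γ.0# ≡ Γ′.0#
    π-onto   : ∀ y → ∃ λ x → π x ≡ y
    π-kernel : ∀ x → π x ≡ Γ′.0# → x ∈ H
    π-vanish : ∀ {x} → x ∈ H → π x ≡ Γ′.0#

module _ {N} (Γ : FinAb N) {H : List (Fin N)} (sub : Subgroup Γ H) where
  open Balance Γ
  open Subgroup sub
  open import Data.List.Membership.DecPropositional (Fin._≟_ {N}) using (_∈?_)

  private
    _~_ : Fin N → Fin N → Set
    x ~ y = x ⊕ ⊖ y ∈ H

    ~-refl : ∀ {x} → x ~ x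
    ~-refl {x} = subst (_∈ H) (sym (inverseʳ x)) 0∈

    ≡⇒~ : ∀ {x y} → x ≡ y → x ~ y
    ≡⇒~ refl = ~-refl

    ~-sym : ∀ {x y} → x ~ y → y ~ x
    ~-sym {x} {y} p = subst (_∈ H)
      (solve (:0 :+ :- (var 0F :+ :- var 1F)) (var 1F :+ :- var 0F) refl (x ∷ y ∷ [])) (minus 0∈ p)

    ~-trans : ∀ {x y z} → x ~ y → y ~ z → x ~ z
    ~-trans {x} {y} {z} p q = subst (_∈ H)
      (solve ((var 0F :+ :- var 1F) :+ :- (var 2F :+ :- var 1F)) (var 0F :+ :- var 2F) refl (x ∷ y ∷ z ∷ []))
      (minus p (~-sym q))

    -- The quotient is first taken as a setoid, the same carrier under congruence modulo H. Choosing
    -- one representative per coset then enumerates it, and `Transport` turns it into a `FinAb`.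
    quotientGroup : AbelianGroup 0ℓ 0ℓ
    quotientGroup = record
      { Carrier = Fin N ; _≈_ = _~_ ; _∙_ = _⊕_ ; ε = 0# ; _⁻¹ = ⊖_
      ; isAbelianGroup = record
        { isGroup = record
          { isMonoid = record
            { isSemigroup = record
              { isMagma = record
                { isEquivalence = record { refl = ~-refl ; sym = ~-sym ; trans = ~-trans }
                ; ∙-cong = λ {x} {y} {u} {v} p q → subst (_∈ H)
                    (solve ((var 0F :+ :- var 1F) :+ :- (var 3F :+ :- var 2F))
                           ((var 0F :+ var 2F) :+ :- (var 1F :+ var 3F)) refl (x ∷ y ∷ u ∷ v ∷ []))
                    (minus p (~-sym q)) }
              ; assoc = λ x y z → ≡⇒~ (assoc x y z) }
            ; identity = (λ x → ≡⇒~ (identityˡ x)) , (λ x → ≡⇒~ (identityʳ x)) }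
          ; inverse = (λ x → ≡⇒~ (inverseˡ x)) , (λ x → ≡⇒~ (inverseʳ x))
          ; ⁻¹-cong = λ {x} {y} p → subst (_∈ H)
              (solve (:0 :+ :- (var 0F :+ :- var 1F)) (:- var 0F :+ :- (:- var 1F)) refl (x ∷ y ∷ [])) (minus 0∈ p) }
        ; comm = λ x y → ≡⇒~ (comm x y) } }

    decSetoid : DecSetoid 0ℓ 0ℓ
    decSetoid = record
      { isDecEquivalence = record
        { isEquivalence = record { refl = ~-refl ; sym = ~-sym ; trans = ~-trans }
        ; _≟_ = λ x y → (x ⊕ ⊖ y) ∈? H } }
    open DecSetoid decSetoid using () renaming (_≟_ to _~?_)

    reps : List (Fin N)
    reps = deduplicate _~?_ (allFin N)

    rep : Fin (length reps) → Fin N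
    rep = lookup reps

    rep-inj : ∀ i j → rep i ~ rep j → i ≡ j
    rep-inj = lookup-AllPairs-injective {R = _~_} ~-sym (deduplicate-! decSetoid (allFin N))

    represented : ∀ x → Any.Any (_~ x) reps
    represented x = Anyₚ.deduplicate⁺ _~?_ (λ p q → ~-trans p q) (Any.map (λ { refl → ~-refl }) (∈-allFin x))

    represent : ∀ x → ∃ λ i → rep i ~ x
    represent x = Any.index (represented x) , lookup-index (represented x)

    hasOrder : HasOrder quotientGroup (length reps)
    hasOrder = rep , rep-inj , represent

    open Transport quotientGroup hasOrder using (finAb; index; index-cong; index-enum; index-inj; index-∙)

    coset : Fin (length reps) × Fin (length H) → Fin N
    coset (i , k) = rep i ⊕ lookup H k

    coset-inj : ∀ p q → coset p ≡ coset q → p ≡ q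
    coset-inj (i , k) (j , l) eq with
      rep-inj i j (subst (_∈ H)
        (deduce (var 3F :+ :- var 2F) (var 0F :+ :- var 1F) (var 1F :+ var 3F) (var 0F :+ var 2F) refl
          (rep i ∷ rep j ∷ lookup H k ∷ lookup H l ∷ []) (sym eq))
        (minus (∈-lookup l) (∈-lookup k)))
    ... | refl = cong (i ,_) (lookup-AllPairs-injective {R = _≡_} sym unique k l (∙-cancelˡ (rep i) _ _ eq))

    coset-split : ∀ x i (x~i : x ~ rep i) → coset (i , Any.index x~i) ≡ x
    coset-split x i x~i = trans (cong (rep i ⊕_) (sym (lookup-index x~i)))
      (solve (var 0F :+ (var 1F :+ :- var 0F)) (var 1F) refl (rep i ∷ x ∷ []))

    abstract
      locate : ∀ x → ∃ λ p → coset p ≡ x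
      locate x = let i , i~x = represent x in (i , Any.index (~-sym i~x)) , coset-split x i (~-sym i~x)

    -- Every element is uniquely a representative plus an element of H. Injections both ways between
    -- `Fin N` and the index pairs give equality of the sizes.
    lagrange : N ≡ length reps * length H
    lagrange = Fin.cantor-schröder-bernstein
      {f = λ x → combine (proj₁ (proj₁ (locate x))) (proj₂ (proj₁ (locate x)))}
      {g = λ m → coset (remQuot (length H) m)}
      (λ {x} {y} eq → let p , q = Fin.combine-injective _ _ _ _ eq in
         trans (sym (proj₂ (locate x))) (trans (cong coset (cong₂ _,_ p q)) (proj₂ (locate y))))
      (λ {m} {m′} eq → trans (sym (Fin.combine-remQuot {length reps} (length H) m))
         (trans (cong (λ p → combine (proj₁ p) (proj₂ p)) (coset-inj _ _ eq))
                (Fin.combine-remQuot {length reps} (length H) m′)))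

  quotient : Quotient Γ H
  quotient = record
    { Γ′ = finAb
    ; order = lagrange
    ; π = index
    ; π-⊕ = index-∙
    ; π-0 = refl
    ; π-onto = λ y → rep y , index-enum y
    ; π-kernel = λ x eq → subst (_∈ H) (solve (var 0F :+ :- :0) (var 0F) refl (x ∷ [])) (index-inj eq)
    ; π-vanish = λ {x} x∈ → index-cong (subst (_∈ H) (solve (var 0F) (var 0F :+ :- :0) refl (x ∷ [])) x∈) }

module _ {N} (Γ : FinAb N) where
  open Balance Γ

  subgroup₂ : ∀ {t} → t ≢ 0# → t ⊕ t ≡ 0# → Subgroup Γ (0# ∷ t ∷ [])
  subgroup₂ {t} t≢0 2t = record
    { unique = ((λ 0≡t → t≢0 (sym 0≡t)) ∷ []) ∷ [] ∷ []
    ; 0∈ = here refl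
    ; minus = λ
      { (here refl) (here refl) → here (inverseʳ 0#)
      ; (here refl) (there (here refl)) → there (here (deduce (:0 :+ :- var 0F) (var 0F) :0 (var 0F :+ var 0F) refl (t ∷ []) (sym 2t)))
      ; (there (here refl)) (here refl) → there (here (solve (var 0F :+ :- :0) (var 0F) refl (t ∷ [])))
      ; (there (here refl)) (there (here refl)) → here (inverseʳ t) } }

  subgroup₃ : ∀ {t} → t ≢ 0# → t ⊕ t ⊕ t ≡ 0# → Subgroup Γ (0# ∷ t ∷ ⊖ t ∷ [])
  subgroup₃ {t} t≢0 3t = record
    { unique = ((λ 0≡t → t≢0 (sym 0≡t)) ∷ (λ 0≡⊖t → t≢0 (deduce (var 0F) :0 :0 (:- var 0F) refl (t ∷ []) 0≡⊖t)) ∷ [])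
             ∷ ((λ t≡⊖t → t≢0 (x+2y (sym 3t) t≡⊖t)) ∷ []) ∷ [] ∷ []
    ; 0∈ = here refl
    ; minus = λ
      { (here refl) (here refl) → here (inverseʳ 0#)
      ; (here refl) (there (here refl)) → there (there (here (identityˡ _)))
      ; (here refl) (there (there (here refl))) → there (here (solve (:0 :+ :- (:- var 0F)) (var 0F) refl (t ∷ [])))
      ; (there (here refl)) (here refl) → there (here (solve (var 0F :+ :- :0) (var 0F) refl (t ∷ [])))
      ; (there (here refl)) (there (here refl)) → here (inverseʳ t)
      ; (there (here refl)) (there (there (here refl))) →
          there (there (here (deduce (var 0F :+ :- (:- var 0F)) (:- var 0F) (var 0F :+ var 0F :+ var 0F) :0 refl (t ∷ []) 3t)))
      ; (there (there (here refl))) (here refl) → there (there (here (solve (:- var 0F :+ :- :0) (:- var 0F) refl (t ∷ []))))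
      ; (there (there (here refl))) (there (here refl)) →
          there (here (deduce (:- var 0F :+ :- var 0F) (var 0F) :0 (var 0F :+ var 0F :+ var 0F) refl (t ∷ []) (sym 3t)))
      ; (there (there (here refl))) (there (there (here refl))) → here (inverseʳ (⊖ t)) } }
    where
    x+2y : 0# ≡ t ⊕ t ⊕ t → t ≡ ⊖ t → t ≡ 0#
    x+2y p q = deduce (var 0F) :0 (var 0F :+ var 0F :+ var 0F :+ :- var 0F) (:0 :+ var 0F) refl (t ∷ [])
      (cong₂ _⊕_ (sym p) (sym q))

-- The order is computed by repeatedly factoring out a subgroup of order p.
order-power : (p : ℕ) → 2 ≤ p → (P : ∀ {N} → FinAb N → Set) →
  (∀ {N} (Γ : FinAb N) → P Γ → ∀ {t} → t ≢ FinAb.0# Γ → ∃ λ H → Subgroup Γ H × length H ≡ p) →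
  (∀ {N} (Γ : FinAb N) {H} (Q : Quotient Γ H) → P Γ → P (Quotient.Γ′ Q)) →
  ∀ N (Γ : FinAb N) → P Γ → ∃ λ k → N ≡ p ^ k
order-power p 2≤p P cyclic descend = <-rec _ step
  where
  step : ∀ N → (∀ {M} → M < N → (Γ : FinAb M) → P Γ → ∃ λ k → M ≡ p ^ k) →
         (Γ : FinAb N) → P Γ → ∃ λ k → N ≡ p ^ k
  step zero rec Γ PΓ = contradiction (FinAb.0# Γ) λ ()
  step (suc zero) rec Γ PΓ = 0 , refl
  step N@(suc (suc _)) rec Γ PΓ =
    let t , t∉ = fresh (FinAb.0# Γ ∷ []) (s≤s (s≤s z≤n))
        H , sub , |H|≡p = cyclic Γ PΓ (λ t≡0 → t∉ (here t≡0))
        Q = quotient Γ sub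
        N≡ = trans (Quotient.order Q) (cong (Quotient.M Q *_) |H|≡p)
        k , M≡ = rec (smaller (Quotient.M Q) N≡) (Quotient.Γ′ Q) (descend Γ Q PΓ)
    in suc k , trans N≡ (trans (cong (_* p) M≡) (ℕₚ.*-comm (p ^ k) p))
    where
    smaller : ∀ M → N ≡ M * p → M < N
    smaller zero ()
    smaller (suc M) eq rewrite eq = ℕₚ.m<m*n (suc M) p 2≤p

module _ {N} (Γ : FinAb N) where
  open FinAb Γ

  Exponent2 Exponent3 : Set
  Exponent2 = ∀ x → x ⊕ x ≡ 0#
  Exponent3 = ∀ x → x ⊕ x ⊕ x ≡ 0#

exponent2⇒order : ∀ {N} (Γ : FinAb N) → Exponent2 Γ → ∃ λ k → N ≡ 2 ^ k
exponent2⇒order {N} = order-power 2 ℕₚ.≤-refl Exponent2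
  (λ Γ e {t} t≢0 → _ , subgroup₂ Γ t≢0 (e t) , refl)
  (λ Γ Q e y → let open Quotient Q ; x , πx≡y = π-onto y in
    subst (λ y → y Γ′.⊕ y ≡ Γ′.0#) πx≡y (trans (sym (π-⊕ x x)) (trans (cong π (e x)) π-0)))
  N

exponent3⇒order : ∀ {N} (Γ : FinAb N) → Exponent3 Γ → ∃ λ k → N ≡ 3 ^ k
exponent3⇒order {N} = order-power 3 (s≤s (s≤s z≤n)) Exponent3
  (λ Γ e {t} t≢0 → _ , subgroup₃ Γ t≢0 (e t) , refl)
  (λ Γ Q e y → let open Quotient Q ; x , πx≡y = π-onto y in
    subst (λ y → y Γ′.⊕ y Γ′.⊕ y ≡ Γ′.0#) πx≡y
      (trans (cong (Γ′._⊕ π x) (sym (π-⊕ x x))) (trans (sym (π-⊕ (x Γ.⊕ x) x)) (trans (cong π (e x)) π-0))))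
  N

-- Existence of balanced splittings

Even Odd : ℕ → Set
Even n = ∃ λ i → n ≡ 2 * i
Odd n  = ∃ λ i → n ≡ 1 + 2 * i

parity : ∀ n → Even n ⊎ Odd n
parity zero = inj₁ (0 , refl)
parity (suc n) with parity n
... | inj₁ (i , refl) = inj₂ (i , refl)
... | inj₂ (i , refl) = inj₁ (suc i , sym (ℕₚ.*-suc 2 i))

2*≢1+2* : ∀ i j → 2 * i ≢ 1 + 2 * j
2*≢1+2* zero    j ()
2*≢1+2* (suc i) zero eq with () ← trans (sym (ℕₚ.*-suc 2 i)) eq
2*≢1+2* (suc i) (suc j) eq = 2*≢1+2* i j (ℕₚ.suc-injective (ℕₚ.suc-injective
  (trans (sym (ℕₚ.*-suc 2 i)) (trans eq (cong suc (ℕₚ.*-suc 2 j))))))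

even≢odd : ∀ {n} → Even n → ¬ Odd n
even≢odd (i , refl) (j , eq) = 2*≢1+2* i j eq

module _ {N : ℕ} (Γ : FinAb N) where
  open Balance Γ

  Symmetric-resp-↭ : ∀ {S T} → S ↭ T → Symmetric S → Symmetric T
  Symmetric-resp-↭ p sy = record
    { unique  = Unique-resp-↭ p unique
    ; closed  = λ x∈ → ∈-resp-↭ p (closed (∈-resp-↭ (↭-sym p) x∈))
    ; torsion = λ t → ∈-resp-↭ p (torsion t) }
    where open Symmetric sy

  involution⇒even : ∀ {t} → t ≢ 0# → t ⊕ t ≡ 0# → Even N
  involution⇒even t≢0 2t = let open Quotient (quotient Γ (subgroup₂ Γ t≢0 2t)) in M , trans order (ℕₚ.*-comm M 2)

  odd⇒torsion-free : Odd N → ∀ {x} → x ⊕ x ≡ 0# → x ≡ 0#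
  odd⇒torsion-free odd {x} 2x = decidable-stable (x ≟ 0#) λ x≢0 → even≢odd (involution⇒even x≢0 2x) odd

  Symmetric-0 : (∀ {x} → x ⊕ x ≡ 0# → x ≡ 0#) → Symmetric (0# ∷ [])
  Symmetric-0 free = record
    { unique  = [] ∷ []
    ; closed  = λ { (here refl) → here ε⁻¹≈ε }
    ; torsion = λ t → here (free t) }

  Involution : Fin N → Set
  Involution t = t ≢ 0# × t ⊕ t ≡ 0#

  involution? : ∀ t → Dec (Involution t)
  involution? t = ¬? (t ≟ 0#) ×-dec (t ⊕ t ≟ 0#)

  -- Cauchy's theorem for the prime 2: without involutions, 0 together with the pairs {d, -d} would
  -- make N odd.
  even⇒involution : Even N → ∃ Involution
  even⇒involution even with any? involution?
  ... | yes found = found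
  ... | no none = contradiction
      (length D , sym (Symmetric-length (0# ∷ []) D (proj₂ (Symmetric-pairs sy)))) (even≢odd even)
    where
    sy : Symmetric (0# ∷ [])
    sy = Symmetric-0 λ {x} 2x → decidable-stable (x ≟ 0#) λ x≢0 → none (x , x≢0 , 2x)
    D = proj₁ (Symmetric-pairs sy)

  split-odd : Odd N → ∀ {a b} → a + b ≡ N → Split a b
  split-odd odd {a} {b} total with parity a | parity b
  ... | inj₁ (i , refl) | inj₁ (j , refl) =
    contradiction odd (even≢odd (i + j , trans (sym total) (sym (ℕₚ.*-distribˡ-+ 2 i j))))
  ... | inj₂ (i , refl) | inj₂ (j , refl) = contradiction odd (even≢odd (1 + i + j , trans (sym total) (eq i j)))
    where
    eq : ∀ i j → (1 + 2 * i) + (1 + 2 * j) ≡ 2 * (1 + i + j)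
    eq = solve-∀
  ... | inj₁ (i , refl) | inj₂ (j , refl) =
    Split-pairs [] (0# ∷ []) [] (Symmetric-0 (odd⇒torsion-free odd)) (sym (identityˡ 0#)) i j refl refl
      (trans (ℕₚ.+-identityʳ _) total)
  ... | inj₂ (i , refl) | inj₁ (j , refl) =
    Split-pairs (0# ∷ []) [] [] (Symmetric-0 (odd⇒torsion-free odd)) (identityˡ 0#) i j refl refl
      (trans (ℕₚ.+-identityʳ _) total)

  open CMSolver (++-commutativeMonoid {A = Fin N}) using (_⊜_) renaming (_⊕_ to _⊹_; solve to arrange)

  -- With 0 left out, both parts consist of pairs {d, -d} and have sum 0.
  split-suc-even : Odd N → ∀ i j → 2 * i + 2 * j + 1 ≡ N → Split (2 * i) (2 * j)
  split-suc-even odd i j total =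
    Split-pairs [] [] (0# ∷ []) (Symmetric-0 (odd⇒torsion-free odd)) refl i j refl refl total

  -- A ∋ s and B ∋ 0, −s, 2s, leaving out −2s.
  split-suc-odd : Odd N → ∀ {s} → s ⊕ s ⊕ s ≢ 0# →
    ∀ i j → (1 + 2 * i) + (3 + 2 * j) + 1 ≡ N → Split (1 + 2 * i) (3 + 2 * j)
  split-suc-odd odd {s} 3s≢0 i j total =
    Split-pairs (s ∷ []) (0# ∷ ⊖ s ∷ s ⊕ s ∷ []) (⊖ (s ⊕ s) ∷ [])
      (Symmetric-resp-↭ (arrange 5 (λ t t′ x x′ o → t ⊹ (t′ ⊹ (x ⊹ (x′ ⊹ o))) ⊜ (x ⊹ (o ⊹ (x′ ⊹ (t ⊹ t′))))) ↭-refl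
          [ s ⊕ s ] [ ⊖ (s ⊕ s) ] [ s ] [ ⊖ s ] [ 0# ])
        (Symmetric-∷ (Symmetric-∷ (Symmetric-0 free) s∉) 2s∉))
      (solve (var 0F :+ :0) (:0 :+ (:- var 0F :+ (var 0F :+ var 0F :+ :0))) refl (s ∷ []))
      i j refl refl total
    where
    free = odd⇒torsion-free odd
    s∉ : s ∉ 0# ∷ []
    s∉ (here refl) = 3s≢0 (solve (:0 :+ :0 :+ :0) :0 refl [])
    2s∉ : s ⊕ s ∉ s ∷ ⊖ s ∷ 0# ∷ []
    2s∉ (here 2s≡s) = s∉ (here (deduce (var 0F) :0 (var 0F :+ var 0F) (var 0F) refl (s ∷ []) 2s≡s))
    2s∉ (there (here 2s≡-s)) = 3s≢0 (deduce (var 0F :+ var 0F :+ var 0F) :0 (var 0F :+ var 0F) (:- var 0F) refl (s ∷ []) 2s≡-s)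
    2s∉ (there (there (here 2s≡0))) = s∉ (here (free 2s≡0))

  -- A ∋ x, y, −(x + y) and B ∋ −x, −y, x + y, leaving out 0.
  split-suc-exp3 : Odd N → Exponent3 Γ →
    ∀ i j → (3 + 2 * i) + (3 + 2 * j) + 1 ≡ N → Split (3 + 2 * i) (3 + 2 * j)
  split-suc-exp3 odd exp i j total =
    Split-pairs (x ∷ y ∷ ⊖ (x ⊕ y) ∷ []) (⊖ x ∷ ⊖ y ∷ x ⊕ y ∷ []) (0# ∷ [])
      (Symmetric-resp-↭ (arrange 7 (λ z z′ y y′ x x′ o → z ⊹ (z′ ⊹ (y ⊹ (y′ ⊹ (x ⊹ (x′ ⊹ o)))))
            ⊜ x ⊹ (y ⊹ (z′ ⊹ (x′ ⊹ (y′ ⊹ (z ⊹ o)))))) ↭-refl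
          [ x ⊕ y ] [ ⊖ (x ⊕ y) ] [ y ] [ ⊖ y ] [ x ] [ ⊖ x ] [ 0# ])
        (Symmetric-∷ (Symmetric-∷ (Symmetric-∷ (Symmetric-0 free) x∉) y∉) z∉))
      (solve (var 0F :+ (var 1F :+ (:- (var 0F :+ var 1F) :+ :0)))
             (:- var 0F :+ (:- var 1F :+ ((var 0F :+ var 1F) :+ :0))) refl (x ∷ y ∷ []))
      i j refl refl total
    where
    free = odd⇒torsion-free odd
    big : 7 ≤ N
    big = subst (7 ≤_) (trans (eq i j) total) (ℕₚ.m≤m+n 7 _)
      where
      eq : ∀ i j → 7 + (2 * i + 2 * j) ≡ (3 + 2 * i) + (3 + 2 * j) + 1
      eq = solve-∀
    fx = fresh (0# ∷ []) (ℕₚ.≤-trans (s≤s (s≤s z≤n)) big)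
    x = proj₁ fx
    x∉ = proj₂ fx
    fy = fresh (x ∷ ⊖ x ∷ 0# ∷ []) (ℕₚ.≤-trans (s≤s (s≤s (s≤s (s≤s z≤n)))) big)
    y = proj₁ fy
    y∉ = proj₂ fy
    z∉ : x ⊕ y ∉ y ∷ ⊖ y ∷ x ∷ ⊖ x ∷ 0# ∷ []
    z∉ (here e) = x∉ (here (deduce (var 0F) :0 (var 0F :+ var 1F) (var 1F) refl (x ∷ y ∷ []) e))
    -- In exponent 3, -2y = y, so x + y = -y would give x = y. The case x + y = -x below is
    -- symmetric.
    z∉ (there (here e)) = y∉ (here (deduce (var 1F) (var 0F) (var 1F :+ var 1F :+ var 1F :+ :- (var 0F :+ var 1F)) (:0 :+ :- (:- var 1F)) refl
      (x ∷ y ∷ []) (cong₂ _⊕_ (exp y) (cong ⊖_ e))))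
    z∉ (there (there (here e))) = y∉ (there (there (here (deduce (var 1F) :0 (var 0F :+ var 1F) (var 0F) refl (x ∷ y ∷ []) e))))
    z∉ (there (there (there (here e)))) = y∉ (here (deduce (var 1F) (var 0F) ((var 0F :+ var 1F) :+ :0) (:- var 0F :+ (var 0F :+ var 0F :+ var 0F)) refl
      (x ∷ y ∷ []) (cong₂ _⊕_ e (sym (exp x)))))
    z∉ (there (there (there (there (here e))))) = y∉ (there (here (deduce (var 1F) (:- var 0F) (var 0F :+ var 1F) :0 refl (x ∷ y ∷ []) e)))

  torsions : List (Fin N)
  torsions = filter (λ x → x ⊕ x ≟ 0#) (allFin N)

  ∈torsions : ∀ {x} → x ⊕ x ≡ 0# → x ∈ torsions
  ∈torsions {x} 2x = ∈-filter⁺ (λ x → x ⊕ x ≟ 0#) (∈-allFin x) 2x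

  torsions⇒2x≡0 : ∀ {x} → x ∈ torsions → x ⊕ x ≡ 0#
  torsions⇒2x≡0 x∈ = proj₂ (∈-filter⁻ (λ x → x ⊕ x ≟ 0#) {xs = allFin N} x∈)

  Symmetric-torsions : Symmetric torsions
  Symmetric-torsions = record
    { unique  = filter⁺ (λ x → x ⊕ x ≟ 0#) (allFin⁺ N)
    ; closed  = λ {x} x∈ → subst (_∈ torsions) (sym (x⊕x≡0⇒⊖x≡x (torsions⇒2x≡0 x∈))) x∈
    ; torsion = ∈torsions }

  2∑≡0 : ∀ xs → (∀ {x} → x ∈ xs → x ⊕ x ≡ 0#) → ∑ xs ⊕ ∑ xs ≡ 0#
  2∑≡0 []       tor = identityˡ 0#
  2∑≡0 (x ∷ xs) tor = trans
    (solve ((var 0F :+ var 1F) :+ (var 0F :+ var 1F)) ((var 0F :+ var 0F) :+ (var 1F :+ var 1F)) refl (x ∷ ∑ xs ∷ []))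
    (trans (cong₂ _⊕_ (tor (here refl)) (2∑≡0 xs (λ x∈ → tor (there x∈)))) (identityˡ 0#))

  -- Pair x with t + x. Each pair sums to 2x + t = t, so the total is a multiple of t.
  ∑-torsions : ∀ {t} → Involution t → ∑ torsions ≡ 0# ⊎ ∑ torsions ≡ t
  ∑-torsions {t} (t≢0 , 2t) =
    let D , p = pairUp (t ⊕_) torsions (Symmetric.unique Symmetric-torsions) closed
          (λ {x} _ → deduce (var 0F :+ (var 0F :+ var 1F)) (var 1F) (var 0F :+ var 0F) :0 refl (t ∷ x ∷ []) 2t)
          (λ {x} _ tx≡x → t≢0 (deduce (var 0F) :0 (var 0F :+ var 1F) (var 1F) refl (t ∷ x ∷ []) tx≡x))
    in subst (λ s → s ≡ 0# ⊎ s ≡ t) (sym (∑-↭ p)) (∑-pairs D λ x∈ → torsions⇒2x≡0 (∈-resp-↭ (↭-sym p) x∈))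
    where
    closed : ∀ {x} → x ∈ torsions → t ⊕ x ∈ torsions
    closed {x} x∈ = ∈torsions (trans
      (solve ((var 0F :+ var 1F) :+ (var 0F :+ var 1F)) ((var 0F :+ var 0F) :+ (var 1F :+ var 1F)) refl (t ∷ x ∷ []))
      (trans (cong₂ _⊕_ 2t (torsions⇒2x≡0 x∈)) (identityˡ 0#)))
    ∑-pairs : ∀ D → (∀ {x} → x ∈ flat (t ⊕_) D → x ⊕ x ≡ 0#) →
      ∑ (flat (t ⊕_) D) ≡ 0# ⊎ ∑ (flat (t ⊕_) D) ≡ t
    ∑-pairs []      tor = inj₁ refl
    ∑-pairs (d ∷ D) tor with ∑-pairs D (λ x∈ → tor (there (there x∈)))
    ... | inj₁ e rewrite e = inj₂ (deduce (var 1F :+ ((var 0F :+ var 1F) :+ :0)) (var 0F) (var 1F :+ var 1F) :0 refl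
      (t ∷ d ∷ []) (tor (here refl)))
    ... | inj₂ e rewrite e = inj₁ (deduce (var 1F :+ ((var 0F :+ var 1F) :+ var 0F)) :0
      ((var 1F :+ var 1F) :+ (var 0F :+ var 0F)) (:0 :+ :0) refl
      (t ∷ d ∷ []) (cong₂ _⊕_ (tor (here refl)) 2t))

  -- The sum lies in {0, t} and in {0, u}, which meet only in 0.
  ∑-torsions≡0 : ∀ {t u} → Involution t → Involution u → t ≢ u → ∑ torsions ≡ 0#
  ∑-torsions≡0 it iu t≢u with ∑-torsions it | ∑-torsions iu
  ... | inj₁ e | _      = e
  ... | inj₂ _ | inj₁ e = e
  ... | inj₂ e | inj₂ f = contradiction (trans (sym e) f) t≢u

  -- Every subset of the 2-torsion part has the same sum as its complement there.
  split-torsions : ∑ torsions ≡ 0# → ∀ {a b} → a + b ≡ N → Split a b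
  split-torsions zero-sum {a} {b} total = choose (length torsions ≤? b)
    where
    T = length torsions
    D = proj₁ (Symmetric-pairs Symmetric-torsions)
    d = length D
    T+2d : T + 2 * d ≡ a + b
    T+2d = trans (Symmetric-length torsions D (proj₂ (Symmetric-pairs Symmetric-torsions))) (sym total)
    1≤T : 1 ≤ T
    1≤T = nonempty (∈torsions (identityˡ 0#))
      where
      nonempty : ∀ {x} {L : List (Fin N)} → x ∈ L → 1 ≤ length L
      nonempty (here _)  = s≤s z≤n
      nonempty (there _) = s≤s z≤n
    cut : ∀ k i j → k ≤ T → a ≡ k + 2 * i → b ≡ T ∸ k + 2 * j → Split a b
    cut k i j k≤T a≡ b≡ = Split-pairs SA SB []
      (subst Symmetric (sym whole) Symmetric-torsions)
      -- The sum of `SA` is its own negative, and the sums of `SA` and `SB` add up to 0; hence they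
      -- agree.
      (deduce (var 0F) (var 1F) ((var 0F :+ var 0F) :+ :0) (:0 :+ (var 0F :+ var 1F)) refl (∑ SA ∷ ∑ SB ∷ [])
        (cong₂ _⊕_ (2∑≡0 SA λ x∈ → torsions⇒2x≡0 (subst (_ ∈_) (take++drop≡id k torsions) (∈-++⁺ˡ x∈)))
                   (trans (sym zero-sum) (trans (cong ∑ (sym (take++drop≡id k torsions))) (∑-++ SA SB)))))
      i j
      (trans a≡ (cong (_+ 2 * i) (sym (trans (length-take k torsions) (ℕₚ.m≤n⇒m⊓n≡m k≤T)))))
      (trans b≡ (cong (_+ 2 * j) (sym (length-drop k torsions))))
      (trans (ℕₚ.+-identityʳ _) total)
      where
      SA = take k torsions
      SB = drop k torsions
      whole : SA ++ SB ++ [] ≡ torsions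
      whole = trans (cong (SA ++_) (++-identityʳ SB)) (take++drop≡id k torsions)
    fill : ∀ k i → k ≤ T → a ≡ k + 2 * i → T ≤ b → Split a b
    fill k i k≤T a≡ T≤b = cut k i (d ∸ i) k≤T a≡ (trans (sym (ℕₚ.m+[n∸m]≡n T∸k≤b)) (cong (T ∸ k +_) r≡))
      where
      r = b ∸ (T ∸ k)
      T∸k≤b = ℕₚ.≤-trans (ℕₚ.m∸n≤m T k) T≤b
      eq : r + 2 * i ≡ 2 * d
      eq = ℕₚ.+-cancelˡ-≡ T _ _ (trans
        (trans (cong (_+ (r + 2 * i)) (sym (ℕₚ.m+[n∸m]≡n k≤T)))
          (trans (shuffle k (T ∸ k) r i) (cong₂ _+_ (sym a≡) (ℕₚ.m+[n∸m]≡n T∸k≤b)))) (sym T+2d))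
        where
        shuffle : ∀ k m r i → k + m + (r + 2 * i) ≡ k + 2 * i + (m + r)
        shuffle = solve-∀
      r≡ : r ≡ 2 * (d ∸ i)
      r≡ = trans (sym (ℕₚ.m+n∸n≡m r (2 * i))) (trans (cong (_∸ 2 * i) eq) (sym (ℕₚ.*-distribˡ-∸ 2 d i)))
    -- If the 2-torsion fits into the second part, at most one of its elements goes to the first
    -- part, to match the parity of a. Otherwise the second part takes b torsion elements and no
    -- pairs.
    choose : Dec (T ≤ b) → Split a b
    choose (yes T≤b) with parity a
    ... | inj₁ (i , e) = fill 0 i z≤n e T≤b
    ... | inj₂ (i , e) = fill 1 i 1≤T e T≤b
    choose (no T≰b) = cut (T ∸ b) d 0 (ℕₚ.m∸n≤m T b)
      (ℕₚ.+-cancelʳ-≡ b _ _ (trans (sym T+2d) (trans (cong (_+ 2 * d) (sym (ℕₚ.m∸n+n≡m b≤T))) (shuffle (T ∸ b) b d))))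
      (sym (trans (ℕₚ.+-identityʳ _) (ℕₚ.m∸[m∸n]≡n b≤T)))
      where
      b≤T = ℕₚ.<⇒≤ (ℕₚ.≰⇒> T≰b)
      shuffle : ∀ m b d → m + b + 2 * d ≡ m + 2 * d + b
      shuffle = solve-∀

module _ {N : ℕ} (Γ : FinAb N) where
  open Balance Γ
  open CMSolver (++-commutativeMonoid {A = Fin N}) using (_⊜_) renaming (_⊕_ to _⊹_; solve to arrange)

  -- An involution of the quotient by {0, ι}, which still has even order, lifts to such an element.
  half-involution : ∀ m → N ≡ 4 * m → ∀ {ι} → Involution Γ ι → (∀ t → Involution Γ t → t ≡ ι) →
    ∃ λ x → x ⊕ x ≡ ι × x ∉ 0# ∷ ι ∷ []
  half-involution m N≡4m {ι} (ι≢0 , 2ι) only =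
    let y , y≢0 , 2y = even⇒involution Γ′ (m , ℕₚ.*-cancelʳ-≡ _ _ 2 (trans (sym order) (trans N≡4m (eq m))))
        x , πx≡y = π-onto y
        x∉ : x ∉ 0# ∷ ι ∷ []
        x∉ x∈ = y≢0 (trans (sym πx≡y) (π-vanish x∈))
        2x∈ = π-kernel (x ⊕ x) (trans (π-⊕ x x) (trans (cong₂ (FinAb._⊕_ Γ′) πx≡y πx≡y) 2y))
    in x , double x∉ 2x∈ , x∉
    where
    open Quotient (quotient Γ (subgroup₂ Γ ι≢0 2ι)) hiding (module Γ; module Γ′)
    eq : ∀ m → 4 * m ≡ 2 * m * 2
    eq = solve-∀
    double : ∀ {x} → x ∉ 0# ∷ ι ∷ [] → x ⊕ x ∈ 0# ∷ ι ∷ [] → x ⊕ x ≡ ι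
    double {x} x∉ (here 2x≡0) = contradiction (there (here (only x ((λ x≡0 → x∉ (here x≡0)) , 2x≡0)))) x∉
    double x∉ (there (here 2x≡ι)) = 2x≡ι

  split-4 : ∀ m → N ≡ 4 * m → ∀ {a b} → 1 ≤ a → 1 ≤ b → a + b ≡ N → Split a b
  split-4 m N≡4m {a} {b} 1≤a 1≤b total =
    let ι , ι-inv = even⇒involution Γ (2 * m , trans N≡4m (eq m)) in go ι ι-inv
    where
    eq : ∀ m → 4 * m ≡ 2 * (2 * m)
    eq = solve-∀
    go : ∀ ι → Involution Γ ι → Split a b
    go ι ι-inv@(ι≢0 , 2ι) with any? (λ t → involution? Γ t ×-dec ¬? (t ≟ ι))
    ... | yes (t , t-inv , t≢ι) = split-torsions Γ (∑-torsions≡0 Γ t-inv ι-inv t≢ι) total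
    ... | no none = unique-case
      where
      only : ∀ t → Involution Γ t → t ≡ ι
      only t t-inv = decidable-stable (t ≟ ι) λ t≢ι → none (t , t-inv , t≢ι)
      half = half-involution m N≡4m ι-inv only
      x = proj₁ half
      2x≡ι = proj₁ (proj₂ half)
      sy : Symmetric (x ∷ ⊖ x ∷ 0# ∷ ι ∷ [])
      sy = Symmetric-∷ (record
        { unique  = ((λ 0≡ι → ι≢0 (sym 0≡ι)) ∷ []) ∷ [] ∷ []
        ; closed  = λ { (here refl) → here ε⁻¹≈ε ; (there (here refl)) → there (here (x⊕x≡0⇒⊖x≡x 2ι)) }
        ; torsion = tor }) (proj₂ (proj₂ half))
        where
        tor : ∀ {y} → y ⊕ y ≡ 0# → y ∈ 0# ∷ ι ∷ []
        tor {y} 2y with y ≟ 0#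
        ... | yes y≡0 = here y≡0
        ... | no y≢0  = there (here (only y (y≢0 , 2y)))
      both-odd : ∀ i j → (1 + 2 * i) + (3 + 2 * j) ≡ N → Split (1 + 2 * i) (3 + 2 * j)
      both-odd i j tot = Split-pairs (x ∷ []) (⊖ x ∷ 0# ∷ ι ∷ []) [] sy
        (deduce (var 0F :+ :0) (:- var 0F :+ (:0 :+ (var 1F :+ :0))) (var 0F :+ var 0F) (var 1F) refl (x ∷ ι ∷ []) 2x≡ι)
        i j refl refl (trans (ℕₚ.+-identityʳ _) tot)
      unique-case : Split a b
      unique-case with parity a | parity b
      ... | inj₁ (i , refl) | inj₂ (j , refl) = contradiction
        (i + j , trans (sym total) (eq₁ i j)) (even≢odd (2 * m , trans N≡4m (eq m)))
        where
        eq₁ : ∀ i j → 2 * i + (1 + 2 * j) ≡ 1 + 2 * (i + j)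
        eq₁ = solve-∀
      ... | inj₂ (i , refl) | inj₁ (j , refl) = contradiction
        (i + j , trans (sym total) (eq₁ i j)) (even≢odd (2 * m , trans N≡4m (eq m)))
        where
        eq₁ : ∀ i j → (1 + 2 * i) + 2 * j ≡ 1 + 2 * (i + j)
        eq₁ = solve-∀
      ... | inj₁ (suc i , refl) | inj₁ (suc j , refl) =
        Split-pairs (x ∷ 0# ∷ []) (⊖ x ∷ ι ∷ []) []
          (Symmetric-resp-↭ Γ (arrange 4 (λ x x′ o i → x ⊹ (x′ ⊹ (o ⊹ i)) ⊜ x ⊹ (o ⊹ (x′ ⊹ i))) ↭-refl
            [ x ] [ ⊖ x ] [ 0# ] [ ι ]) sy)
          (deduce (var 0F :+ (:0 :+ :0)) (:- var 0F :+ (var 1F :+ :0)) (var 0F :+ var 0F) (var 1F) refl (x ∷ ι ∷ []) 2x≡ι)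
          i j (ℕₚ.*-suc 2 i) (ℕₚ.*-suc 2 j) (trans (ℕₚ.+-identityʳ _) total)
      ... | inj₂ (i , refl) | inj₂ (suc j , refl) = subst (Split _) (sym (3+ j)) (both-odd i j (trans (cong (1 + 2 * i +_) (sym (3+ j))) total))
        where
        3+ : ∀ j → 1 + 2 * suc j ≡ 3 + 2 * j
        3+ = solve-∀
      ... | inj₂ (suc i , refl) | inj₂ (zero , refl) = Split-sym (subst (Split _) (sym (3+ i)) (both-odd 0 i
          (trans (ℕₚ.+-comm 1 (3 + 2 * i)) (trans (cong (_+ 1) (sym (3+ i))) total))))
        where
        3+ : ∀ j → 1 + 2 * suc j ≡ 3 + 2 * j
        3+ = solve-∀
      -- Two classes of size 1 would mean N = 2, which is no multiple of 4.
      ... | inj₂ (zero , refl) | inj₂ (zero , refl) = contradiction (trans total N≡4m) (2≢4m m)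
        where
        2≢4m : ∀ m → 2 ≢ 4 * m
        2≢4m zero ()
        2≢4m (suc m) e with () ← trans e (ℕₚ.*-suc 4 m)
      unique-case | inj₁ (zero , refl) | inj₁ _ = contradiction 1≤a λ ()
      unique-case | inj₁ (suc _ , refl) | inj₁ (zero , refl) = contradiction 1≤b λ ()

  -- The three conditions make 0, g and σ - g distinct. If no g satisfied them, 2g = σ would hold
  -- for all g outside {0, σ}; suitable g and h then give σ = 2(g + h) = 2σ = 0, and the exponent
  -- would be 2.
  pair-with-sum-σ : 5 ≤ N → ¬ Exponent2 Γ → ∃ λ g → g ≢ 0# × g ≢ σ × g ⊕ g ≢ σ
  pair-with-sum-σ 5≤N ¬exp2 with any? (λ g → ¬? (g ≟ 0#) ×-dec (¬? (g ≟ σ) ×-dec ¬? (g ⊕ g ≟ σ)))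
  ... | yes found = found
  ... | no none = contradiction exp2 ¬exp2
    where
    double : ∀ g → g ≢ 0# → g ≢ σ → g ⊕ g ≡ σ
    double g g≢0 g≢σ = decidable-stable (g ⊕ g ≟ σ) λ 2g≢σ → none (g , g≢0 , g≢σ , 2g≢σ)
    fg = fresh (0# ∷ σ ∷ []) (ℕₚ.≤-trans (s≤s (s≤s (s≤s z≤n))) 5≤N)
    g = proj₁ fg
    2g : g ⊕ g ≡ σ
    2g = double g (λ e → proj₂ fg (here e)) (λ e → proj₂ fg (there (here e)))
    -- Avoiding -g ensures g + h ≠ 0, and avoiding g ensures g + h ≠ 2g = σ. Four excluded elements
    -- account for the bound 5.
    fh = fresh (0# ∷ σ ∷ g ∷ ⊖ g ∷ []) 5≤N
    h = proj₁ fh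
    2h : h ⊕ h ≡ σ
    2h = double h (λ e → proj₂ fh (here e)) (λ e → proj₂ fh (there (here e)))
    2[g+h] : (g ⊕ h) ⊕ (g ⊕ h) ≡ σ
    2[g+h] = double (g ⊕ h)
      (λ e → proj₂ fh (there (there (there (here (deduce (var 1F) (:- var 0F) (var 0F :+ var 1F) :0 refl (g ∷ h ∷ []) e))))))
      (λ e → proj₂ fh (there (there (here (deduce (var 1F) (var 0F) (var 0F :+ var 1F) (var 0F :+ var 0F) refl (g ∷ h ∷ [])
        (trans e (sym 2g)))))))
    σ≡0 : σ ≡ 0#
    σ≡0 = trans (sym 2[g+h]) (trans
      (solve ((var 0F :+ var 1F) :+ (var 0F :+ var 1F)) ((var 0F :+ var 0F) :+ (var 1F :+ var 1F)) refl (g ∷ h ∷ []))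
      (trans (cong₂ _⊕_ 2g 2h) σ⊕σ))
    exp2 : Exponent2 Γ
    exp2 x with x ≟ 0#
    ... | yes x≡0 = trans (cong₂ _⊕_ x≡0 x≡0) (identityˡ 0#)
    ... | no x≢0 = trans (double x x≢0 (λ x≡σ → x≢0 (trans x≡σ σ≡0))) σ≡0

  -- A = {0}, leaving out a pair of elements with sum σ.
  split-star : 5 ≤ N → ¬ Exponent2 Γ → ∀ {b} → b + 3 ≡ N → Split 1 b
  split-star 5≤N ¬exp2 {b} b+3≡N = record
    { As = 0# ∷ [] ; Bs = R ; Rs = g ∷ h ∷ []
    ; length-A = refl
    ; length-B = ℕₚ.+-cancelʳ-≡ 3 _ _ (trans (ℕₚ.+-comm (length R) 3) (trans (length-allFin-↭ cover) (sym b+3≡N)))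
    ; covers = ↭-trans cover (arrange 4 (λ o g h r → (o ⊹ (g ⊹ h)) ⊹ r ⊜ o ⊹ (r ⊹ (g ⊹ h))) ↭-refl [ 0# ] [ g ] [ h ] R)
    ; balanced = deduce (:0 :+ :0) (var 2F) (var 1F) (:0 :+ (var 0F :+ ((var 1F :+ :- var 0F) :+ var 2F)))
        refl (g ∷ σ ∷ ∑ R ∷ []) (∑-↭ cover) }
    where
    fg = pair-with-sum-σ 5≤N ¬exp2
    g = proj₁ fg
    h = σ ⊕ ⊖ g
    comp = complement {S = 0# ∷ g ∷ h ∷ []}
      (((λ e → proj₁ (proj₂ fg) (sym e)) ∷ (λ e → proj₁ (proj₂ (proj₂ fg)) (deduce (var 0F) (var 1F) :0 (var 1F :+ :- var 0F) refl (g ∷ σ ∷ []) e)) ∷ [])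
       ∷ ((λ e → proj₂ (proj₂ (proj₂ fg)) (deduce (var 0F :+ var 0F) (var 1F) (var 0F) (var 1F :+ :- var 0F) refl (g ∷ σ ∷ []) e)) ∷ [])
       ∷ [] ∷ [])
    R = proj₁ comp
    cover = proj₁ (proj₂ comp)

-- Realising weighted degrees

trues falses : ∀ {n} → (Fin n → Bool) → ℕ
trues {zero}  c = 0
trues {suc n} c = if c zero then suc (trues (c ∘ suc)) else trues (c ∘ suc)
falses {zero}  c = 0
falses {suc n} c = if c zero then falses (c ∘ suc) else suc (falses (c ∘ suc))

trues+falses : ∀ {n} (c : Fin n → Bool) → trues c + falses c ≡ n
trues+falses {zero}  c = refl
trues+falses {suc n} c with c zero
... | true  = cong suc (trues+falses (c ∘ suc))
... | false = trans (ℕₚ.+-suc _ _) (cong suc (trues+falses (c ∘ suc)))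

Bichromatic : ∀ {n} → Graph n → (Fin n → Bool) → Fin n → Fin n → Set
Bichromatic G c u v = Adj G u v × c v ≡ not (c u)

-- Only connectedness of the bichromatic edges is demanded; edges inside a class are allowed, so
-- bipartiteness of G is not assumed.
record Colouring {n} (G : Graph n) : Set where
  field
    colour : Fin n → Bool
    root   : Fin n
    walk   : ∀ v → Star (Bichromatic G colour) v root

unique-tabulate⇒injective : ∀ {X : Set} {n} (w : Fin n → X) → Unique (tabulate w) → ∀ i j → w i ≡ w j → i ≡ j
unique-tabulate⇒injective w u zero zero e = refl
unique-tabulate⇒injective w (p ∷ _) zero (suc j) e = contradiction e (All.lookup p (∈-tabulate⁺ j))
unique-tabulate⇒injective w (p ∷ _) (suc i) zero e = contradiction (sym e) (All.lookup p (∈-tabulate⁺ i))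
unique-tabulate⇒injective w (_ ∷ u) (suc i) (suc j) e = cong suc (unique-tabulate⇒injective (w ∘ suc) u i j e)

module Realise {N} (Γ : FinAb N) where
  open Balance Γ

  private
    Sum : ∀ {n} → (Fin n → Fin N) → Fin N
    Sum = sumFin abelianGroup

  Sum-cong : ∀ {n} {f g : Fin n → Fin N} → (∀ i → f i ≡ g i) → Sum f ≡ Sum g
  Sum-cong {zero}  p = refl
  Sum-cong {suc n} p = cong₂ _⊕_ (p zero) (Sum-cong (p ∘ suc))

  Sum-⊕ : ∀ {n} (f g : Fin n → Fin N) → Sum (λ i → f i ⊕ g i) ≡ Sum f ⊕ Sum g
  Sum-⊕ {zero}  f g = sym (identityˡ 0#)
  Sum-⊕ {suc n} f g = trans (cong (f zero ⊕ g zero ⊕_) (Sum-⊕ (f ∘ suc) (g ∘ suc)))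
    (solve (var 0F :+ var 1F :+ (var 2F :+ var 3F)) (var 0F :+ var 2F :+ (var 1F :+ var 3F)) refl
      (f zero ∷ g zero ∷ Sum (f ∘ suc) ∷ Sum (g ∘ suc) ∷ []))

  Sum-⊖ : ∀ {n} (f : Fin n → Fin N) → Sum (λ i → ⊖ f i) ≡ ⊖ Sum f
  Sum-⊖ {zero}  f = sym ε⁻¹≈ε
  Sum-⊖ {suc n} f = trans (cong (⊖ f zero ⊕_) (Sum-⊖ (f ∘ suc)))
    (solve (:- var 0F :+ :- var 1F) (:- (var 0F :+ var 1F)) refl (f zero ∷ Sum (f ∘ suc) ∷ []))

  Sum-0 : ∀ {n} {f : Fin n → Fin N} → (∀ i → f i ≡ 0#) → Sum f ≡ 0#
  Sum-0 {zero}  p = refl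
  Sum-0 {suc n} p = trans (cong₂ _⊕_ (p zero) (Sum-0 (p ∘ suc))) (identityˡ 0#)

  δ : ∀ {n} → Fin n → Fin n → Fin N → Fin N
  δ i j x = if does (i ≟ j) then x else 0#

  Sum-δ : ∀ {n} (i : Fin n) (f : Fin n → Fin N) → Sum (λ j → δ i j (f j)) ≡ f i
  Sum-δ zero f = trans (cong (f zero ⊕_) (Sum-0 {f = λ j → δ zero (suc j) (f (suc j))} (λ _ → refl))) (identityʳ _)
  Sum-δ (suc i) f = trans (identityˡ _) (trans (Sum-cong (λ j → step j)) (Sum-δ i (f ∘ suc)))
    where
    step : ∀ j → δ (suc i) (suc j) (f (suc j)) ≡ δ i j (f (suc j))
    step j with i ≟ j
    ... | yes _ = refl
    ... | no _  = refl

  sgn : Bool → Fin N → Fin N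
  sgn true  x = x
  sgn false x = ⊖ x

  sgn-0 : ∀ b → sgn b 0# ≡ 0#
  sgn-0 true  = refl
  sgn-0 false = ε⁻¹≈ε

  sgn-⊕ : ∀ b x y → sgn b (x ⊕ y) ≡ sgn b x ⊕ sgn b y
  sgn-⊕ true  x y = refl
  sgn-⊕ false x y = solve (:- (var 0F :+ var 1F)) (:- var 0F :+ :- var 1F) refl (x ∷ y ∷ [])

  sgn-not : ∀ b x → sgn (not b) (⊖ x) ≡ sgn b x
  sgn-not true  x = ⁻¹-involutive x
  sgn-not false x = refl

  sgn-sgn : ∀ b x → sgn b (sgn b x) ≡ x
  sgn-sgn true  x = refl
  sgn-sgn false x = ⁻¹-involutive x

  Sum-sgn : ∀ {n} b (f : Fin n → Fin N) → Sum (λ i → sgn b (f i)) ≡ sgn b (Sum f)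
  Sum-sgn true  f = refl
  Sum-sgn false f = Sum-⊖ f

  module _ {n} (G : Graph n) where

    Realisable : (Fin n → Fin N) → Set
    Realisable w = Σ (Labelling abelianGroup G) λ f → ∀ z → wdeg abelianGroup f z ≡ w z

    realisable-cong : ∀ {w w′} → (∀ z → w z ≡ w′ z) → Realisable w → Realisable w′
    realisable-cong p (f , q) = f , λ z → trans (q z) (p z)

    realisable-0 : Realisable (λ _ → 0#)
    realisable-0 = record { lab = λ _ _ → 0# ; lab-sym = λ _ _ → refl } , λ z → Sum-0 (λ u → zero′ (adj G z u))
      where
      zero′ : ∀ b → (if b then 0# else 0#) ≡ 0#
      zero′ true  = refl
      zero′ false = refl

    private
      if-⊕ : ∀ b x y → (if b then x ⊕ y else 0#) ≡ (if b then x else 0#) ⊕ (if b then y else 0#)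
      if-⊕ true  x y = refl
      if-⊕ false x y = sym (identityˡ 0#)

    realisable-⊕ : ∀ {w w′} → Realisable w → Realisable w′ → Realisable (λ z → w z ⊕ w′ z)
    realisable-⊕ (f , p) (g , q) =
      record { lab = λ i j → lab f i j ⊕ lab g i j ; lab-sym = λ i j → cong₂ _⊕_ (lab-sym f i j) (lab-sym g i j) }
      , λ z → trans (Sum-cong (λ u → if-⊕ (adj G z u) (lab f z u) (lab g z u)))
                    (trans (Sum-⊕ (λ u → if adj G z u then lab f z u else 0#) (λ u → if adj G z u then lab g z u else 0#))
                           (cong₂ _⊕_ (p z) (q z)))
      where open Labelling

    realisable-Sum : ∀ {k} {w : Fin k → Fin n → Fin N} → (∀ i → Realisable (w i)) → Realisable (λ z → Sum (λ i → w i z))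
    realisable-Sum {zero}  r = realisable-0
    realisable-Sum {suc k} r = realisable-⊕ (r zero) (realisable-Sum (r ∘ suc))

    -- The label is x on the edge uv and 0 elsewhere, written as a sum over both orientations to
    -- make it symmetric.
    realisable-edge : ∀ {u v} → Adj G u v → ∀ x → Realisable (λ z → δ u z x ⊕ δ v z x)
    realisable-edge {u} {v} u~v x = f , λ z →
      trans (Sum-cong (λ j → if-⊕ (adj G z j) (δ u z (δ v j x)) (δ v z (δ u j x))))
        (trans (Sum-⊕ (λ j → if adj G z j then δ u z (δ v j x) else 0#) (λ j → if adj G z j then δ v z (δ u j x) else 0#))
          (cong₂ _⊕_ (half u v u~v z) (half v u (trans (adj-sym G v u) u~v) z)))
      where
      δ-swap : ∀ i j k l → δ {n} i j (δ {n} k l x) ≡ δ k l (δ i j x)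
      δ-swap i j k l with i ≟ j | k ≟ l
      ... | yes _ | yes _ = refl
      ... | yes _ | no _  = refl
      ... | no _  | yes _ = refl
      ... | no _  | no _  = refl
      f : Labelling abelianGroup G
      f = record
        { lab = λ i j → δ u i (δ v j x) ⊕ δ v i (δ u j x)
        ; lab-sym = λ i j → trans (comm _ _) (cong₂ _⊕_ (δ-swap v i u j) (δ-swap u i v j)) }
      half : ∀ u v → Adj G u v → ∀ z → Sum (λ j → if adj G z j then δ u z (δ v j x) else 0#) ≡ δ u z x
      half u v u~v z = trans (Sum-cong pull) (trans (Sum-δ v (λ j → if adj G z j then δ u z x else 0#)) atv)
        where
        pull : ∀ j → (if adj G z j then δ u z (δ v j x) else 0#) ≡ δ v j (if adj G z j then δ u z x else 0#)
        pull j with adj G z j | v ≟ j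
        ... | true  | yes _ = refl
        ... | false | yes _ = refl
        ... | false | no _  = refl
        ... | true  | no _  with u ≟ z
        ...   | yes _ = refl
        ...   | no _  = refl
        atv : (if adj G z v then δ u z x else 0#) ≡ δ u z x
        atv with u ≟ z
        ... | yes refl rewrite u~v = refl
        ... | no _ with adj G z v
        ...   | true  = refl
        ...   | false = refl

    module _ (c : Fin n → Bool) where

      -- In signed weights an edge labelled ± x carries x from one end to the other, so walks telescope.
      realisable-walk : ∀ {u v} → Star (Bichromatic G c) u v → ∀ x →
        Realisable (λ z → sgn (c z) (δ u z x ⊕ ⊖ δ v z x))
      realisable-walk {u} Walk.ε x =
        realisable-cong (λ z → sym (trans (cong (sgn (c z)) (inverseʳ (δ u z x))) (sgn-0 (c z)))) realisable-0
      realisable-walk {u} {v} (_◅_ {j = w} (u~w , flip) s) x =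
        realisable-cong (λ z → trans (sym (sgn-⊕ (c z) _ _)) (cong (sgn (c z))
            (solve ((var 0F :+ :- var 1F) :+ (var 1F :+ :- var 2F)) (var 0F :+ :- var 2F) refl (δ u z x ∷ δ w z x ∷ δ v z x ∷ []))))
          (realisable-⊕ (realisable-cong signed (realisable-edge u~w (sgn (c u) x))) (realisable-walk s x))
        where
        u≢w : u ≢ w
        u≢w refl with () ← trans (sym u~w) (irrefl G u)
        signed : ∀ z → δ u z (sgn (c u) x) ⊕ δ w z (sgn (c u) x) ≡ sgn (c z) (δ u z x ⊕ ⊖ δ w z x)
        signed z with u ≟ z | w ≟ z
        ... | yes refl | yes refl = contradiction refl u≢w
        ... | yes refl | no _ = trans (identityʳ _) (cong (sgn (c z)) (solve (var 0F) (var 0F :+ :- :0) refl (x ∷ [])))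
        ... | no _ | yes refl = trans (identityˡ _) (trans (sym (sgn-not (c u) x))
              (trans (cong (λ b → sgn b (⊖ x)) (sym flip)) (cong (sgn (c w)) (sym (identityˡ (⊖ x))))))
        ... | no _ | no _ = trans (identityˡ 0#) (sym (trans (cong (sgn (c z)) (inverseʳ 0#)) (sgn-0 (c z))))

      -- Each vertex v exchanges its signed weight with the root along its walk. Every vertex then
      -- has the right weight, apart from a surplus at the root that is the negated total of all
      -- signed weights, and this total is 0.
      realisable-balanced : ∀ r → (∀ v → Star (Bichromatic G c) v r) →
        ∀ w → Sum (λ v → sgn (c v) (w v)) ≡ 0# → Realisable w
      realisable-balanced r walks w bal =
        realisable-cong value (realisable-Sum (λ v → realisable-walk (walks v) (x v)))
        where
        x : Fin n → Fin N
        x v = sgn (c v) (w v)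
        δ-comm : ∀ z v y → δ {n} v z y ≡ δ z v y
        δ-comm z v y with v ≟ z | z ≟ v
        ... | yes _ | yes _ = refl
        ... | no _  | no _  = refl
        ... | yes p | no q  = contradiction (sym p) q
        ... | no p  | yes q = contradiction (sym q) p
        at-root : ∀ z → Sum (λ v → ⊖ δ r z (x v)) ≡ 0#
        at-root z with r ≟ z
        ... | yes _ = trans (Sum-⊖ x) (trans (cong ⊖_ bal) ε⁻¹≈ε)
        ... | no _  = Sum-0 {n} (λ _ → ε⁻¹≈ε)
        value : ∀ z → Sum (λ v → sgn (c z) (δ v z (x v) ⊕ ⊖ δ r z (x v))) ≡ w z
        value z = trans (Sum-sgn (c z) (λ v → δ v z (x v) ⊕ ⊖ δ r z (x v)))
          (trans (cong (sgn (c z)) (trans (Sum-⊕ (λ v → δ v z (x v)) (λ v → ⊖ δ r z (x v)))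
                   (trans (cong₂ _⊕_ (trans (Sum-cong (λ v → δ-comm z v (x v))) (Sum-δ z x)) (at-root z)) (identityʳ _))))
                 (sgn-sgn (c z) (w z)))

  assign : ∀ {n} (c : Fin n → Bool) As Bs → length As ≡ trues c → length Bs ≡ falses c →
    ∃ λ (w : Fin n → Fin N) → tabulate w ↭ As ++ Bs × Sum (λ i → sgn (c i) (w i)) ≡ ∑ As ⊕ ⊖ ∑ Bs
  assign {zero} c [] [] _ _ = (λ ()) , ↭-refl , sym (inverseʳ 0#)
  assign {suc n} c As Bs la lb with c zero
  assign {suc n} c (a ∷ As) Bs la lb | true =
    let w , p , q = assign (c ∘ suc) As Bs (ℕₚ.suc-injective la) lb in
    (λ { zero → a ; (suc i) → w i }) , prep a p ,
    trans (cong (a ⊕_) q)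
      (solve (var 0F :+ (var 1F :+ :- var 2F)) (var 0F :+ var 1F :+ :- var 2F) refl (a ∷ ∑ As ∷ ∑ Bs ∷ []))
  assign {suc n} c As (b ∷ Bs) la lb | false =
    let w , p , q = assign (c ∘ suc) As Bs la (ℕₚ.suc-injective lb) in
    (λ { zero → b ; (suc i) → w i }) , ↭-trans (prep b p) (↭-sym (shift b As Bs)) ,
    trans (cong (⊖ b ⊕_) q)
      (solve (:- var 0F :+ (var 1F :+ :- var 2F)) (var 1F :+ :- (var 0F :+ var 2F)) refl (b ∷ ∑ As ∷ ∑ Bs ∷ []))

  -- The weights on the vertices form a permutation of `As ++ Bs`, a part of the repetition-free
  -- list of all elements, so they are distinct.
  irregular-fromSplit : ∀ {n} {G : Graph n} (C : Colouring G) →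
    Split (trues (Colouring.colour C)) (falses (Colouring.colour C)) →
    Σ (Labelling abelianGroup G) (Irregular abelianGroup)
  irregular-fromSplit {G = G} C s =
    let w , p , q = assign colour As Bs length-A length-B
        f , val = realisable-balanced G colour root walk w
          (trans q (x≈y⇒x∙y⁻¹≈ε balanced))
        distinct : Unique (tabulate w)
        distinct = Unique-resp-↭ (↭-sym p) (take-unique (As ++ Bs)
          (Unique-resp-↭ (↭-trans covers (subst (λ l → As ++ Bs ++ Rs ↭ l) (sym (++-assoc As Bs Rs)) ↭-refl)) (allFin⁺ N)))
    in f , λ u v e → unique-tabulate⇒injective w distinct u v (trans (sym (val u)) (trans e (val v)))
    where
    open Split s
    open Colouring C
    take-unique : ∀ (xs : List (Fin N)) {ys} → Unique (xs ++ ys) → Unique xs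
    take-unique []       _       = []
    take-unique (x ∷ xs) (p ∷ u) = head-all xs p ∷ take-unique xs u
      where
      head-all : ∀ {P : Fin N → Set} xs {ys} → All.All P (xs ++ ys) → All.All P xs
      head-all []       _       = []
      head-all (x ∷ xs) (p ∷ ps) = p ∷ head-all xs ps

-- Colourings from spanning trees

falses≡trues-not : ∀ {n} (c : Fin n → Bool) → falses c ≡ trues (not ∘ c)
falses≡trues-not {zero}  c = refl
falses≡trues-not {suc n} c with c zero
... | true  = falses≡trues-not (c ∘ suc)
... | false = cong suc (falses≡trues-not (c ∘ suc))

trues≥1 : ∀ {n} {c : Fin n → Bool} u → c u ≡ true → 1 ≤ trues c
trues≥1 {c = c} zero    p rewrite p = s≤s z≤n
trues≥1 {c = c} (suc u) p with c zero
... | true  = s≤s z≤n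
... | false = trues≥1 u p

trues≥2 : ∀ {n} {c : Fin n → Bool} u v → u ≢ v → c u ≡ true → c v ≡ true → 2 ≤ trues c
trues≥2 zero zero u≢v _ _ = contradiction refl u≢v
trues≥2 zero (suc v) _ p q rewrite p = s≤s (trues≥1 v q)
trues≥2 (suc u) zero _ p q rewrite q = s≤s (trues≥1 u p)
trues≥2 {c = c} (suc u) (suc v) u≢v p q with c zero
... | true  = ℕₚ.≤-trans (trues≥2 u v (u≢v ∘ cong suc) p q) (ℕₚ.n≤1+n _)
... | false = trues≥2 u v (u≢v ∘ cong suc) p q

trues≡0 : ∀ {n} {c : Fin n → Bool} → (∀ v → c v ≡ false) → trues c ≡ 0
trues≡0 {zero}  p = refl
trues≡0 {suc n} p rewrite p zero = trues≡0 (p ∘ suc)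

trues≡1 : ∀ {n} {c : Fin n → Bool} h → c h ≡ true → (∀ v → v ≢ h → c v ≡ false) → trues c ≡ 1
trues≡1 zero    p q rewrite p = cong suc (trues≡0 (λ v → q (suc v) λ ()))
trues≡1 (suc h) p q rewrite q zero (λ ()) = trues≡1 h p (λ v v≢h → q (suc v) (v≢h ∘ Fin.suc-injective))

length≤ : ∀ {n} {L : List (Fin n)} → Unique L → length L ≤ n
length≤ {L = L} u = Fin.injective⇒≤ {f = lookup L} (λ {i} {j} → lookup-AllPairs-injective {R = _≡_} sym u i j)

module _ {n} (G : Graph n) where
  open import Data.List.Membership.DecPropositional (Fin._≟_ {n}) using (_∈?_)

  Adj-sym : ∀ {u v} → Adj G u v → Adj G v u
  Adj-sym {u} {v} e = trans (adj-sym G v u) e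

  Adj⇒≢ : ∀ {u v} → Adj G u v → u ≢ v
  Adj⇒≢ {u} e refl with () ← trans (sym e) (irrefl G u)

  Bichromatic-sym : ∀ {c u v} → Bichromatic G c u v → Bichromatic G c v u
  Bichromatic-sym {c} {u} (e , p) = Adj-sym e , trans (sym (not-involutive (c u))) (cong not (sym p))

  private
    -- A tree grown so far, with vertex list L. The walks stay inside L, so they survive a
    -- recolouring of vertices outside L.
    record Grown (r : Fin n) (L : List (Fin n)) : Set where
      field
        unique : Unique L
        root∈  : r ∈ L
        colour : Fin n → Bool
        walk   : ∀ {v} → v ∈ L → Star (λ u w → Bichromatic G colour u w × u ∈ L × w ∈ L) v r

    leave : ∀ {L u v} → Star (Adj G) u v → u ∈ L → v ∉ L → ∃ λ x → ∃ λ y → x ∈ L × y ∉ L × Adj G x y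
    leave Walk.ε u∈ v∉ = contradiction u∈ v∉
    leave {L} {u} (_◅_ {j = w} e s) u∈ v∉ with w ∈? L
    ... | yes w∈ = leave s w∈ v∉
    ... | no w∉  = u , w , u∈ , w∉ , e

    extend : ∀ {r L x y} → Grown r L → x ∈ L → y ∉ L → Adj G x y → Grown r (y ∷ L)
    extend {r} {L} {x} {y} g x∈ y∉ x~y = record
      { unique = All.tabulate (λ z∈ y≡z → y∉ (subst (_∈ L) (sym y≡z) z∈)) ∷ unique
      ; root∈  = there root∈
      ; colour = colour′
      ; walk   = walk′ }
      where
      open Grown g
      colour′ : Fin n → Bool
      -- The new vertex gets the colour opposite to its neighbour x, which makes the tree edge
      -- bichromatic.
      colour′ v = if does (v ≟ y) then not (colour x) else colour v
      new : colour′ y ≡ not (colour x)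
      new rewrite dec-true (y ≟ y) refl = refl
      old : ∀ {v} → v ∈ L → colour′ v ≡ colour v
      old {v} v∈ rewrite dec-false (v ≟ y) (λ { refl → y∉ v∈ }) = refl
      lift : ∀ {v} → Star (λ u w → Bichromatic G colour u w × u ∈ L × w ∈ L) v r →
             Star (λ u w → Bichromatic G colour′ u w × u ∈ y ∷ L × w ∈ y ∷ L) v r
      lift = Walk.map λ { ((e , p) , u∈ , w∈) →
        (e , trans (old w∈) (trans p (cong not (sym (old u∈))))) , there u∈ , there w∈ }
      walk′ : ∀ {v} → v ∈ y ∷ L → Star (λ u w → Bichromatic G colour′ u w × u ∈ y ∷ L × w ∈ y ∷ L) v r
      walk′ (there v∈)  = lift (walk v∈)
      walk′ (here refl) =
        ((Adj-sym x~y , trans (old x∈) (trans (sym (not-involutive (colour x))) (cong not (sym new)))) , here refl , there x∈)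
        ◅ lift (walk x∈)

    -- A walk from the root to a missing vertex has an edge leaving L, and its far end is added. The
    -- bound makes k large enough: at k = 0 one more vertex would give more than n distinct ones.
    grow : Connected G → ∀ {r} k L → Grown r L → n ≤ length L + k → ∃ λ M → Grown r M × (∀ v → v ∈ M)
    grow conn {r} k L g bound with any? (λ v → ¬? (v ∈? L))
    ... | no none = L , g , λ v → decidable-stable (v ∈? L) λ v∉ → none (v , v∉)
    grow conn {r} k L g bound | yes (v , v∉) with leave (conn r v) (Grown.root∈ g) v∉
    grow conn {r} zero L g bound | yes _ | x , y , x∈ , y∉ , e =
      contradiction (ℕₚ.≤-trans (length≤ (Grown.unique (extend g x∈ y∉ e))) (subst (n ≤_) (ℕₚ.+-identityʳ _) bound)) ℕₚ.1+n≰n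
    grow conn {r} (suc k) L g bound | yes _ | x , y , x∈ , y∉ , e =
      grow conn k (y ∷ L) (extend g x∈ y∉ e) (subst (n ≤_) (ℕₚ.+-suc _ k) bound)

  spanning-colouring : Connected G → Fin n → Colouring G
  spanning-colouring conn r =
    let M , g , all = grow conn n (r ∷ []) start (ℕₚ.n≤1+n n)
    in record { colour = Grown.colour g ; root = r ; walk = λ v → Walk.map proj₁ (Grown.walk g (all v)) }
    where
    start : Grown r (r ∷ [])
    start = record { unique = [] ∷ [] ; root∈ = here refl ; colour = λ _ → true ; walk = λ { (here refl) → Walk.ε } }

  module _ (C : Colouring G) where
    open Colouring C

    neighbour : ∀ {u v} → u ≢ v → ∃ λ w → Adj G u w × colour w ≡ not (colour u)
    neighbour {u} {v} u≢v with walk u ◅◅ Walk.reverse Bichromatic-sym (walk v)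
    ... | Walk.ε = contradiction refl u≢v
    ... | _◅_ {j = w} (e , p) _ = w , e , p

    Class : Bool → Fin n → Set
    Class b v = colour v ≡ b

    class-inhabited : ∀ {u v : Fin n} → u ≢ v → ∀ b → ∃ (Class b)
    class-inhabited {u} u≢v b with colour u Bool.≟ b
    ... | yes p = u , p
    ... | no p = let w , _ , q = neighbour u≢v in w , trans q (sym (Bool.¬-not (p ∘ sym)))

    -- Each vertex has a neighbour in the other class. If h is alone in its class, that neighbour is
    -- h for every other vertex.
    hub : ∀ b → ¬ (∃ λ u → ∃ λ v → u ≢ v × Class b u × Class b v) → ∀ h → Class b h → ∀ v → v ≢ h → Adj G h v
    hub b single h h∈ v v≢h =
      let w , e , p = neighbour v≢h in
      Adj-sym (subst (Adj G v) (only w (trans p (trans (cong not (v∉ v≢h)) (not-involutive b)))) e)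
      where
      only : ∀ w → Class b w → w ≡ h
      only w w∈ = decidable-stable (w ≟ h) λ w≢h → single (w , h , w≢h , w∈ , h∈)
      v∉ : ∀ {v} → v ≢ h → colour v ≡ not b
      v∉ {v} v≢h = Bool.¬-not λ v∈ → v≢h (only v v∈)

  -- Stars, and colourings with two vertices in each class

  Hub : Fin n → Set
  Hub h = ∀ v → v ≢ h → Adj G h v

  hub-colouring : ∀ {h} → Hub h → Colouring G
  hub-colouring {h} hb = record { colour = λ v → does (v ≟ h) ; root = h ; walk = go }
    where
    go : ∀ v → Star (Bichromatic G (λ v → does (v ≟ h))) v h
    go v with v ≟ h
    ... | yes refl = Walk.ε
    ... | no v≢h = (Adj-sym (hb v v≢h) , trans (dec-true (h ≟ h) refl) (cong not (sym (dec-false (v ≟ h) v≢h)))) ◅ Walk.ε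

  trues-hub : ∀ {h} (hb : Hub h) → trues (Colouring.colour (hub-colouring hb)) ≡ 1
  trues-hub {h} hb = trues≡1 h (dec-true (h ≟ h) refl) (λ v v≢h → dec-false (v ≟ h) v≢h)

  Wide : Set
  Wide = Σ (Colouring G) λ C → 2 ≤ trues (Colouring.colour C) × 2 ≤ falses (Colouring.colour C)

  IsStar : Set
  IsStar = ∃ λ h → Hub h × (∀ x y → x ≢ h → y ≢ h → ¬ Adj G x y)

  -- If some edge xy avoids the hub h, take {h, x} as one class: y and all remaining vertices are
  -- joined to h directly, and x reaches h through y. A fourth vertex makes the other class large
  -- enough.
  hub⇒star-or-wide : 4 ≤ n → ∀ {h} → Hub h → IsStar ⊎ Wide
  hub⇒star-or-wide 4≤n {h} hb with any? (λ x → any? (λ y → ¬? (x ≟ h) ×-dec (¬? (y ≟ h) ×-dec (adj G x y Bool.≟ true))))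
  ... | no none = inj₁ (h , hb , λ x y x≢h y≢h e → none (x , y , x≢h , y≢h , e))
  ... | yes (x , y , x≢h , y≢h , x~y) = inj₂ (record { colour = c ; root = h ; walk = go } , two-true , two-false)
    where
    c : Fin n → Bool
    c v = does (v ≟ h) ∨ does (v ≟ x)
    c-h : c h ≡ true
    c-h rewrite dec-true (h ≟ h) refl = refl
    c-x : c x ≡ true
    c-x rewrite dec-false (x ≟ h) x≢h | dec-true (x ≟ x) refl = refl
    c-other : ∀ {v} → v ≢ h → v ≢ x → c v ≡ false
    c-other {v} v≢h v≢x rewrite dec-false (v ≟ h) v≢h | dec-false (v ≟ x) v≢x = refl
    y≢x : y ≢ x
    y≢x = Adj⇒≢ (Adj-sym x~y)
    to-h : ∀ {v} → v ≢ h → v ≢ x → Bichromatic G c v h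
    to-h {v} v≢h v≢x = Adj-sym (hb v v≢h) , trans c-h (cong not (sym (c-other v≢h v≢x)))
    go : ∀ v → Star (Bichromatic G c) v h
    go v with v ≟ h | v ≟ x
    ... | yes refl | _ = Walk.ε
    ... | no v≢h | yes refl = (x~y , trans (c-other y≢h y≢x) (cong not (sym c-x))) ◅ to-h y≢h y≢x ◅ Walk.ε
    ... | no v≢h | no v≢x = to-h v≢h v≢x ◅ Walk.ε
    two-true : 2 ≤ trues c
    two-true = trues≥2 h x (x≢h ∘ sym) c-h c-x
    two-false : 2 ≤ falses c
    two-false =
      let z , z∉ = fresh (h ∷ x ∷ y ∷ []) 4≤n in
      subst (2 ≤_) (sym (falses≡trues-not c)) (trues≥2 y z (λ y≡z → z∉ (there (there (here (sym y≡z)))))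
        (cong not (c-other y≢h y≢x)) (cong not (c-other (λ z≡h → z∉ (here z≡h)) (λ z≡x → z∉ (there (here z≡x))))))

  two-in-class? : ∀ (c : Fin n → Bool) b → Dec (∃ λ u → ∃ λ v → u ≢ v × c u ≡ b × c v ≡ b)
  two-in-class? c b = any? (λ u → any? (λ v → ¬? (u ≟ v) ×-dec ((c u Bool.≟ b) ×-dec (c v Bool.≟ b))))

  -- Either a spanning-tree colouring has two vertices in each class, or one class is a single
  -- vertex and that vertex is a hub.
  star-or-wide : 4 ≤ n → Connected G → IsStar ⊎ Wide
  star-or-wide 4≤n conn = go (two-in-class? colour true) (two-in-class? colour false)
    where
    r = proj₁ (fresh [] (ℕₚ.≤-trans (s≤s z≤n) 4≤n))
    s = fresh (r ∷ []) (ℕₚ.≤-trans (s≤s (s≤s z≤n)) 4≤n)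
    r≢s : r ≢ proj₁ s
    r≢s r≡s = proj₂ s (here (sym r≡s))
    C = spanning-colouring conn r
    open Colouring C using (colour)
    go : Dec (∃ λ u → ∃ λ v → u ≢ v × colour u ≡ true × colour v ≡ true) →
         Dec (∃ λ u → ∃ λ v → u ≢ v × colour u ≡ false × colour v ≡ false) → IsStar ⊎ Wide
    go (yes (u , v , u≢v , p , q)) (yes (u′ , v′ , u′≢v′ , p′ , q′)) = inj₂ (C , trues≥2 u v u≢v p q ,
      subst (2 ≤_) (sym (falses≡trues-not colour)) (trues≥2 u′ v′ u′≢v′ (cong not p′) (cong not q′)))
    go (no single) _ = let h , h∈ = class-inhabited C r≢s true in hub⇒star-or-wide 4≤n (hub C true single h h∈)
    go (yes _) (no single) = let h , h∈ = class-inhabited C r≢s false in hub⇒star-or-wide 4≤n (hub C false single h h∈)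

  colouring-both : 2 ≤ n → Connected G →
    Σ (Colouring G) λ C → 1 ≤ trues (Colouring.colour C) × 1 ≤ falses (Colouring.colour C)
  colouring-both 2≤n conn =
    let r , _ = fresh [] (ℕₚ.≤-trans (s≤s z≤n) 2≤n)
        s , s∉ = fresh (r ∷ []) 2≤n
        C = spanning-colouring conn r
        r≢s : r ≢ s
        r≢s r≡s = s∉ (here (sym r≡s))
        u , p = class-inhabited C r≢s true
        v , q = class-inhabited C r≢s false
    in C , trues≥1 u p , subst (1 ≤_) (sym (falses≡trues-not (Colouring.colour C))) (trues≥1 v (cong not q))

isStar⇒≅ : ∀ {m} (G : Graph (suc m)) → IsStar G → G ≅ Star-graph m
isStar⇒≅ {m} G (h , hb , none) = ↔⇒⤖ π , λ i j → trans (cong₂ _xor_ (at i) (at j)) (edges i j)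
  where
  π = transpose h zero
  nonzero : ∀ {k : Fin (suc m)} → k ≢ zero → isZero k ≡ false
  nonzero {zero}  k≢0 = contradiction refl k≢0
  nonzero {suc k} _   = refl
  at : ∀ k → isZero (π ⟨$⟩ʳ k) ≡ does (k ≟ h)
  at k with k ≟ h
  ... | yes refl = refl
  ... | no k≢h with k ≟ zero
  ...   | no k≢0 = nonzero k≢0
  ...   | yes refl = nonzero (k≢h ∘ sym)
  edges : ∀ i j → does (i ≟ h) xor does (j ≟ h) ≡ adj G i j
  edges i j with i ≟ h | j ≟ h
  ... | yes refl | yes refl = sym (irrefl G i)
  ... | yes refl | no j≢h   = sym (hb j j≢h)
  ... | no i≢h   | yes refl = sym (Adj-sym G (hb i i≢h))
  ... | no i≢h   | no j≢h   = sym (Bool.¬-not (none i j i≢h j≢h))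

≅⇒isStar : ∀ {n m} {G : Graph n} → G ≅ Star-graph m → IsStar G
≅⇒isStar {n} {m} {G} (σ , iso) = h , hb , none
  where
  open Bijection σ using (to; strictlySurjective; injective)
  h = proj₁ (strictlySurjective zero)
  to-h : to h ≡ zero
  to-h = proj₂ (strictlySurjective zero)
  other : ∀ {v} → v ≢ h → isZero (to v) ≡ false
  other {v} v≢h with to v in eq
  ... | zero  = contradiction (injective (trans eq (sym to-h))) v≢h
  ... | suc _ = refl
  hb : Hub G h
  hb v v≢h = trans (sym (iso h v)) (cong₂ _xor_ (cong isZero to-h) (other v≢h))
  none : ∀ x y → x ≢ h → y ≢ h → ¬ Adj G x y
  none x y x≢h y≢h e with () ← trans (sym e) (trans (sym (iso x y)) (cong₂ _xor_ (other x≢h) (other y≢h)))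

-- Lower bounds

module _ (s : ℕ) {{_ : NonZero s}} where

  private
    +-%-cong : ∀ {a b c d} → a % s ≡ b % s → c % s ≡ d % s → (a + c) % s ≡ (b + d) % s
    +-%-cong {a} {b} {c} {d} p q = trans (%-distribˡ-+ a c s) (trans (cong₂ (λ x y → (x + y) % s) p q) (sym (%-distribˡ-+ b d s)))

    inverse : ∀ x → ((s ∸ x % s) + x) % s ≡ 0 % s
    inverse x = trans (+-%-cong {s ∸ x % s} {s ∸ x % s} {x} {x % s} refl (sym (m%n%n≡m%n x s)))
      (trans (cong (_% s) (ℕₚ.m∸n+n≡m (ℕₚ.<⇒≤ (m%n<n x s)))) (trans (n%n≡0 s) (sym (m*n%n≡0 0 s))))

  -- ℤ modulo s is encoded on ℕ with congruence as equality, so that the operation is ordinary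
  -- addition; `s ∸ x % s` represents -x.
  cyclic : AbelianGroup 0ℓ 0ℓ
  cyclic = record
    { Carrier = ℕ ; _≈_ = λ x y → x % s ≡ y % s ; _∙_ = _+_ ; ε = 0 ; _⁻¹ = λ x → s ∸ x % s
    ; isAbelianGroup = record
      { isGroup = record
        { isMonoid = record
          { isSemigroup = record
            { isMagma = record
              { isEquivalence = record { refl = refl ; sym = sym ; trans = trans }
              ; ∙-cong = λ {a} {b} {c} {d} → +-%-cong {a} {b} {c} {d} }
            ; assoc = λ x y z → cong (_% s) (ℕₚ.+-assoc x y z) }
          ; identity = (λ x → refl) , (λ x → cong (_% s) (ℕₚ.+-identityʳ x)) }
        ; inverse = inverse , λ x → trans (cong (_% s) (ℕₚ.+-comm x _)) (inverse x)
        ; ⁻¹-cong = λ p → cong (λ r → (s ∸ r) % s) p }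
      ; comm = λ x y → cong (_% s) (ℕₚ.+-comm x y) } }

  cyclic-order : HasOrder cyclic s
  cyclic-order = toℕ
    , (λ i j p → toℕ-injective (trans (sym (m<n⇒m%n≡m (toℕ<n i))) (trans p (m<n⇒m%n≡m (toℕ<n j)))))
    , (λ x → fromℕ< (m%n<n x s) , trans (cong (_% s) (toℕ-fromℕ< (m%n<n x s))) (m%n%n≡m%n x s))

×-order : ∀ {A B : AbelianGroup 0ℓ 0ℓ} {a b} → HasOrder A a → HasOrder B b → HasOrder (Direct.abelianGroup A B) (a * b)
×-order {A} {B} {a} {b} (e , e-inj , e-onto) (f , f-inj , f-onto) =
  (λ k → e (proj₁ (remQuot {a} b k)) , f (proj₂ (remQuot {a} b k))) ,
  (λ k l (p , q) → trans (sym (Fin.combine-remQuot {a} b k))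
     (trans (cong₂ combine (e-inj _ _ p) (f-inj _ _ q)) (Fin.combine-remQuot {a} b l))) ,
  λ (x , y) → let i , p = e-onto x ; j , q = f-onto y in combine i j ,
    AbelianGroup.trans A (AbelianGroup.reflexive A (cong (e ∘ proj₁) (Fin.remQuot-combine {a} {b} i j))) p ,
    AbelianGroup.trans B (AbelianGroup.reflexive B (cong (f ∘ proj₂) (Fin.remQuot-combine {a} {b} i j))) q

ℤ₃^ : ℕ → AbelianGroup 0ℓ 0ℓ
ℤ₃^ zero    = Terminal.abelianGroup
ℤ₃^ (suc k) = Direct.abelianGroup (cyclic 3) (ℤ₃^ k)

ℤ₃^-order : ∀ k → HasOrder (ℤ₃^ k) (3 ^ k)
ℤ₃^-order zero    = (λ _ → _) , (λ { zero zero _ → refl }) , λ _ → zero , _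
ℤ₃^-order (suc k) = ×-order {cyclic 3} {ℤ₃^ k} (cyclic-order 3) (ℤ₃^-order k)

ℤ₃^-exponent : ∀ k → let open AbelianGroup (ℤ₃^ k) in ∀ x → x ∙ x ∙ x ≈ ε
ℤ₃^-exponent zero    _       = _
ℤ₃^-exponent (suc k) (x , y) = trans (cong (_% 3) (thrice x)) (m*n%n≡0 x 3) , ℤ₃^-exponent k y
  where
  thrice : ∀ x → x + x + x ≡ x * 3
  thrice = solve-∀

finℤ₃^ : ∀ k → FinAb (3 ^ k)
finℤ₃^ k = Transport.finAb (ℤ₃^ k) (ℤ₃^-order k)

finℤ₃^-exponent : ∀ k → Exponent3 (finℤ₃^ k)
finℤ₃^-exponent k i = trans (index-cong (∙-congʳ (enum-index (enum i ∙ enum i)))) (index-cong (ℤ₃^-exponent k (enum i)))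
  where
  open AbelianGroup (ℤ₃^ k) using (_∙_; ∙-congʳ)
  open Transport (ℤ₃^ k) (ℤ₃^-order k)

finCyclic : ∀ s {{_ : NonZero s}} → FinAb s
finCyclic s = Transport.finAb (cyclic s) (cyclic-order s)

goodOrder-toFinAb : ∀ {n} {G : Graph n} {N} → GoodOrder G N → (Γ : FinAb N) →
  Σ (Labelling (FinAb.abelianGroup Γ) G) (Irregular (FinAb.abelianGroup Γ))
goodOrder-toFinAb good Γ = good (FinAb.abelianGroup Γ) (id , (λ _ _ → id) , λ x → x , refl)

-- Obstructions from counting and from sums of weights

irregular⇒≤ : ∀ {n s} {G : Graph n} (Γ : FinAb s) (f : Labelling (FinAb.abelianGroup Γ) G) →
  Irregular (FinAb.abelianGroup Γ) f → n ≤ s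
irregular⇒≤ Γ f irr = Fin.injective⇒≤ {f = wdeg (FinAb.abelianGroup Γ) f} (λ {u} {v} → irr u v)

¬goodOrder-< : ∀ {n} {G : Graph n} {s} → 1 ≤ s → s < n → ¬ GoodOrder G s
¬goodOrder-< {s = suc s} _ s<n good =
  let f , irr = goodOrder-toFinAb good (finCyclic (suc s)) in ℕₚ.<⇒≱ s<n (irregular⇒≤ (finCyclic (suc s)) f irr)

module _ {N} (Γ : FinAb N) where
  open Balance Γ
  open Realise Γ

  Sum : ∀ {n} → (Fin n → Fin N) → Fin N
  Sum = sumFin abelianGroup

  ∑-tabulate : ∀ {n} (f : Fin n → Fin N) → ∑ (tabulate f) ≡ Sum f
  ∑-tabulate {zero}  f = refl
  ∑-tabulate {suc n} f = cong (f zero ⊕_) (∑-tabulate (f ∘ suc))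

  -- By symmetry each entry above the diagonal occurs twice, and the diagonal vanishes; x is the sum
  -- above the diagonal.
  double-sum : ∀ {n} (M : Fin n → Fin n → Fin N) → (∀ i j → M i j ≡ M j i) → (∀ i → M i i ≡ 0#) →
    ∃ λ x → Sum (λ i → Sum (M i)) ≡ x ⊕ x
  double-sum {zero}  M sy diag = 0# , sym (identityˡ 0#)
  double-sum {suc n} M sy diag =
    let x , p = double-sum (λ i j → M (suc i) (suc j)) (λ i j → sy (suc i) (suc j)) (diag ∘ suc)
        row = Sum (λ j → M zero (suc j))
    in row ⊕ x , trans
      (cong₂ _⊕_ (cong (_⊕ row) (diag zero))
        (trans (Sum-⊕ (λ i → M (suc i) zero) (λ i → Sum (λ j → M (suc i) (suc j))))
          (cong₂ _⊕_ (Sum-cong (λ i → sy (suc i) zero)) p)))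
      (solve ((:0 :+ var 0F) :+ (var 0F :+ (var 1F :+ var 1F))) ((var 0F :+ var 1F) :+ (var 0F :+ var 1F)) refl (row ∷ x ∷ []))

  module _ {n} {G : Graph n} (f : Labelling abelianGroup G) where

    private
      M : Fin n → Fin n → Fin N
      M i j = if adj G i j then Labelling.lab f i j else 0#

      M-sym : ∀ i j → M i j ≡ M j i
      M-sym i j = cong₂ (λ b x → if b then x else 0#) (adj-sym G i j) (Labelling.lab-sym f i j)

      M-diag : ∀ i → M i i ≡ 0#
      M-diag i rewrite irrefl G i = refl

    handshake : ∃ λ x → Sum (wdeg abelianGroup f) ≡ x ⊕ x
    handshake = double-sum M M-sym M-diag

    -- Every edge contains h, so its label is counted once in the weight of h and once at its other
    -- end.
    star-sum : ∀ h → (∀ x y → x ≢ h → y ≢ h → ¬ Adj G x y) →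
      Sum (wdeg abelianGroup f) ≡ wdeg abelianGroup f h ⊕ wdeg abelianGroup f h
    star-sum h none = trans (Sum-cong λ v → trans (Sum-cong (entry v))
        (Sum-⊕ (λ j → δ h v (M h j)) (λ j → δ h j (M v h))))
      (trans (Sum-⊕ (λ v → Sum (λ j → δ h v (M h j))) (λ v → Sum (λ j → δ h j (M v h))))
        (cong₂ _⊕_ (trans (Sum-cong pull) (Sum-δ h (λ _ → Sum (M h))))
                   (trans (Sum-cong (λ v → Sum-δ h (λ _ → M v h))) (Sum-cong (λ v → M-sym v h)))))
      where
      entry : ∀ v j → M v j ≡ δ h v (M h j) ⊕ δ h j (M v h)
      entry v j with h ≟ v | h ≟ j
      ... | yes refl | yes refl = sym (trans (cong₂ _⊕_ (M-diag h) refl) (identityˡ _))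
      ... | yes refl | no _     = sym (identityʳ _)
      ... | no _     | yes refl = sym (identityˡ _)
      ... | no h≢v   | no h≢j with adj G v j in eq
      ...   | true  = contradiction eq (none v j (h≢v ∘ sym) (h≢j ∘ sym))
      ...   | false = sym (identityˡ _)
      pull : ∀ v → Sum (λ j → δ h v (M h j)) ≡ δ h v (Sum (M h))
      pull v with h ≟ v
      ... | yes _ = refl
      ... | no _  = Sum-0 {n} (λ _ → refl)

  module _ {n} (w : Fin n → Fin N) (inj : ∀ u v → w u ≡ w v → u ≡ v) where

    private
      unique : Unique (tabulate w)
      unique = tabulate⁺ (λ {u} {v} → inj u v)

    missing : ∃ λ R → allFin N ↭ tabulate w ++ R × (∀ {x} → x ∈ R → x ∉ tabulate w)
    missing = let R , p , _ , out , _ = complement unique in R , p , out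

    missing-length : ∀ R → allFin N ↭ tabulate w ++ R → n + length R ≡ N
    missing-length R p = trans (cong (_+ length R) (sym (length-tabulate w)))
      (trans (sym (length-++ (tabulate w))) (length-allFin-↭ p))

  -- The sum of the weighted degrees is twice some element, while χ does not vanish on the sum of all elements.
  ¬irregular-character : (χ : Fin N → Bool) → (∀ x y → χ (x ⊕ y) ≡ χ x xor χ y) → χ σ ≡ true →
    {G : Graph N} (f : Labelling abelianGroup G) → ¬ Irregular abelianGroup f
  ¬irregular-character χ χ-⊕ χσ f irr = contradiction
    (trans (sym χσ) (trans (cong χ (trans (∑-↭ covers) (trans (∑-tabulate w) (proj₂ (handshake f)))))
      (trans (χ-⊕ x x) (xor-same (χ x))))) λ ()
    where
    w = wdeg abelianGroup f
    x = proj₁ (handshake f)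
    covers : allFin N ↭ tabulate w
    covers with missing w irr
    ... | [] , p , _ = ↭-trans p (↭-reflexive (++-identityʳ _))
    ... | R@(_ ∷ rs) , p , _ = contradiction (missing-length w irr R p) (ℕₚ.m+1+n≢m N)

  -- In exponent 3 the only element that is not a weighted degree would have to be that of the centre.
  ¬irregular-star : Exponent3 Γ → ∀ {n} {G : Graph n} → suc n ≡ N → IsStar G →
    (f : Labelling abelianGroup G) → ¬ Irregular abelianGroup f
  ¬irregular-star exp {n} 1+n≡N (h , _ , none) f irr = conclude (missing w irr)
    where
    w = wdeg abelianGroup f
    σ≡0 : σ ≡ 0#
    -- From 3σ = 0 and 2σ = 0.
    σ≡0 = deduce (var 0F) :0 ((var 0F :+ var 0F :+ var 0F) :+ :0) (:0 :+ (var 0F :+ var 0F)) refl (σ ∷ [])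
      (cong₂ _⊕_ (exp σ) (sym σ⊕σ))
    conclude : ¬ (∃ λ R → allFin N ↭ tabulate w ++ R × (∀ {x} → x ∈ R → x ∉ tabulate w))
    conclude ([] , p , _) = ℕₚ.1+n≢n (trans 1+n≡N (trans (sym (missing-length w irr [] p)) (ℕₚ.+-identityʳ n)))
    conclude (R@(_ ∷ _ ∷ rs) , p , _) = contradiction
      (ℕₚ.+-cancelˡ-≡ n _ _ (trans (missing-length w irr R p) (trans (sym 1+n≡N) (ℕₚ.+-comm 1 n)))) λ ()
    conclude (g ∷ [] , p , out) = out (here refl) (subst (_∈ tabulate w) (sym g≡wh) (∈-tabulate⁺ h))
      where
      sum : 0# ≡ (w h ⊕ w h) ⊕ (g ⊕ 0#)
      sum = trans (sym σ≡0) (trans (∑-↭ p) (trans (∑-++ (tabulate w) (g ∷ []))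
        (cong (_⊕ (g ⊕ 0#)) (trans (∑-tabulate w) (star-sum f h none)))))
      g≡wh : g ≡ w h
      -- The total gives 2w(h) + g = 0, while exponent 3 gives 3w(h) = 0; hence g = w(h).
      g≡wh = deduce (var 0F) (var 1F) (((var 1F :+ var 1F) :+ (var 0F :+ :0)) :+ :0) (:0 :+ (var 1F :+ var 1F :+ var 1F)) refl (g ∷ w h ∷ [])
        (cong₂ _⊕_ (sym sum) (sym (exp (w h))))

-- The parity character of a cyclic group of even order

odd : ℕ → Bool
odd zero    = false
odd (suc n) = not (odd n)

odd-+ : ∀ m n → odd (m + n) ≡ odd m xor odd n
odd-+ zero    n = refl
odd-+ (suc m) n with odd m | odd-+ m n
... | true  | p rewrite p = not-involutive (odd n)
... | false | p rewrite p = refl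

odd-2* : ∀ n → odd (2 * n) ≡ false
odd-2* n rewrite ℕₚ.+-identityʳ n = trans (odd-+ n n) (xor-same (odd n))

odd-% : ∀ k {{_ : NonZero (2 * k)}} a → odd (a % (2 * k)) ≡ odd a
odd-% k a = sym (trans (cong odd (trans (m≡m%n+[m/n]*n a (2 * k)) (cong (a % (2 * k) +_) (shuffle (a / (2 * k)) k))))
  (trans (odd-+ (a % (2 * k)) _) (trans (cong (odd (a % (2 * k)) xor_) (odd-2* (a / (2 * k) * k))) (xor-false _))))
  where
  shuffle : ∀ q k → q * (2 * k) ≡ 2 * (q * k)
  shuffle = solve-∀
  xor-false : ∀ b → b xor false ≡ b
  xor-false true  = refl
  xor-false false = refl

total : ∀ {n} → (Fin n → ℕ) → ℕ
total {zero}  f = 0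
total {suc n} f = f zero + total (f ∘ suc)

total-suc : ∀ {n} (f : Fin n → ℕ) → total (suc ∘ f) ≡ n + total f
total-suc {zero}  f = refl
total-suc {suc n} f = cong suc (trans (cong (f zero +_) (total-suc (f ∘ suc))) (shuffle (f zero) n (total (f ∘ suc))))
  where
  shuffle : ∀ a n t → a + (n + t) ≡ n + (a + t)
  shuffle = solve-∀

-- The sum starts with 0 + 1, and each step of k adds four consecutive numbers n, ..., n + 3 with
-- even sum 2(2n + 3).
odd-total-toℕ : ∀ k → odd (total {2 + 4 * k} toℕ) ≡ true
odd-total-toℕ zero = refl
odd-total-toℕ (suc k) = trans (cong (λ m → odd (total {2 + m} toℕ)) (ℕₚ.*-suc 4 k))
  (trans (cong odd (trans (four (2 + 4 * k)) (shuffle (2 + 4 * k) (total {2 + 4 * k} toℕ))))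
    (trans (odd-+ (2 * (2 * (2 + 4 * k) + 3)) (total {2 + 4 * k} toℕ))
      (trans (cong (_xor odd (total {2 + 4 * k} toℕ)) (odd-2* (2 * (2 + 4 * k) + 3))) (odd-total-toℕ k))))
  where
  four : ∀ n → total {4 + n} toℕ ≡ (3 + n) + ((2 + n) + ((1 + n) + (n + total {n} toℕ)))
  four n = trans (step (3 + n)) (cong (3 + n +_) (trans (step (2 + n)) (cong (2 + n +_)
    (trans (step (1 + n)) (cong (1 + n +_) (step n))))))
    where
    step : ∀ n → total {suc n} toℕ ≡ n + total {n} toℕ
    step n = total-suc {n} toℕ
  shuffle : ∀ n t → (3 + n) + ((2 + n) + ((1 + n) + (n + t))) ≡ 2 * (2 * n + 3) + t
  shuffle = solve-∀

module Parity (n k : ℕ) {{_ : NonZero n}} (n≡ : n ≡ 2 * k) where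
  open Balance (finCyclic n) using (_⊕_; 0#; ∑)
  open Transport (cyclic n) (cyclic-order n) using (enum-index)

  χ : Fin n → Bool
  χ x = odd (toℕ x)

  -- The modulus is a fresh variable here so that its equation with `2 * k` can be matched by
  -- `refl`.
  odd-mod : ∀ m {{_ : NonZero m}} → m ≡ 2 * k → ∀ a b → a % m ≡ b % m → odd a ≡ odd b
  odd-mod _ refl a b p = trans (sym (odd-% k a)) (trans (cong odd p) (odd-% k b))

  χ-⊕ : ∀ x y → χ (x ⊕ y) ≡ χ x xor χ y
  χ-⊕ x y = trans (odd-mod n n≡ (toℕ (x ⊕ y)) (toℕ x + toℕ y) (enum-index (toℕ x + toℕ y))) (odd-+ (toℕ x) (toℕ y))

  χ-∑ : ∀ {m} (g : Fin m → Fin n) → χ (∑ (tabulate g)) ≡ odd (total (toℕ ∘ g))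
  χ-∑ {zero}  g = odd-mod n n≡ (toℕ 0#) 0 (enum-index 0)
  χ-∑ {suc m} g = trans (χ-⊕ (g zero) (∑ (tabulate (g ∘ suc))))
    (trans (cong (χ (g zero) xor_) (χ-∑ (g ∘ suc))) (sym (odd-+ (toℕ (g zero)) _)))

-- In ℤₙ with n ≡ 2 modulo 4, parity is a homomorphism that kills all doubles, while the sum of all
-- elements is odd.
¬goodOrder-≡2 : ∀ {n} k → n ≡ 2 + 4 * k → {G : Graph n} → ¬ GoodOrder G n
¬goodOrder-≡2 {n@(suc _)} k n≡ good =
  let f , irr = goodOrder-toFinAb good (finCyclic n) in
  ¬irregular-character (finCyclic n) χ χ-⊕ (trans (χ-∑ id) all) f irr
  where
  eq : ∀ k → 2 + 4 * k ≡ 2 * (1 + 2 * k)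
  eq = solve-∀
  open Parity n (1 + 2 * k) (trans n≡ (eq k))
  all : odd (total {n} toℕ) ≡ true
  all = trans (cong (λ m → odd (total {m} toℕ)) n≡) (odd-total-toℕ k)

¬goodOrder-star : ∀ {n} k {G : Graph n} → suc n ≡ 3 ^ k → IsStar G → ¬ GoodOrder G (3 ^ k)
¬goodOrder-star k 1+n≡ star good =
  let f , irr = goodOrder-toFinAb good (finℤ₃^ k) in
  ¬irregular-star (finℤ₃^ k) (finℤ₃^-exponent k) 1+n≡ star f irr

-- Orders n, n + 1 and n + 2

3^2q≡1+8t : ∀ q → ∃ λ t → 3 ^ (2 * q) ≡ 1 + 8 * t
3^2q≡1+8t zero = 0 , refl
3^2q≡1+8t (suc q) =
  let t , p = 3^2q≡1+8t q in
  1 + 9 * t , trans (cong (3 ^_) (ℕₚ.*-suc 2 q)) (trans (cong (λ x → 3 * (3 * x)) p) (eq t))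
  where
  eq : ∀ t → 3 * (3 * (1 + 8 * t)) ≡ 1 + 8 * (1 + 9 * t)
  eq = solve-∀

3^[2q+1]≡3+24t : ∀ q → 1 ≤ q → ∃ λ t → 3 ^ (2 * q + 1) ≡ 3 + 24 * t × 1 ≤ t
3^[2q+1]≡3+24t q@(suc _) _ =
  let t , p = 3^2q≡1+8t q in
  t , trans (cong (3 ^_) (ℕₚ.+-comm (2 * q) 1)) (trans (cong (3 *_) p) (eq t)) , positive t p
  where
  eq : ∀ t → 3 * (1 + 8 * t) ≡ 3 + 24 * t
  eq = solve-∀
  positive : ∀ t → 3 ^ (2 * q) ≡ 1 + 8 * t → 1 ≤ t
  positive zero p = contradiction (subst (3 ≤_) p (ℕₚ.^-monoʳ-≤ 3 {1} {2 * q} (s≤s z≤n))) λ { (s≤s ()) }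
  positive (suc t) _ = s≤s z≤n

-- Even powers of 3 are 1 modulo 8, so k is odd; the case k = 1 is excluded by j ≥ 1.
3^k≡3+4j⇒k≡2q+1 : ∀ k j → 3 ^ k ≡ 3 + 4 * j → 1 ≤ j → ∃ λ q → 1 ≤ q × k ≡ 2 * q + 1
3^k≡3+4j⇒k≡2q+1 k j p 1≤j with parity k
... | inj₁ (q , refl) =
  let t , r = 3^2q≡1+8t q in
  contradiction (ℕₚ.*-cancelˡ-≡ _ _ 2 (ℕₚ.suc-injective (trans (eq₁ t) (trans (sym r) (trans p (eq₂ j)))))) (2*≢1+2* (2 * t) j)
  where
  eq₁ : ∀ t → 1 + 2 * (2 * (2 * t)) ≡ 1 + 8 * t
  eq₁ = solve-∀
  eq₂ : ∀ j → 3 + 4 * j ≡ 1 + 2 * (1 + 2 * j)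
  eq₂ = solve-∀
... | inj₂ (suc q , refl) = suc q , s≤s z≤n , ℕₚ.+-comm 1 (2 * suc q)
... | inj₂ (zero , refl) = contradiction p (ℕₚ.<⇒≢ (ℕₚ.<-≤-trans (s≤s (s≤s (s≤s (s≤s z≤n)))) (ℕₚ.+-monoʳ-≤ 3 (ℕₚ.*-monoʳ-≤ 4 1≤j))))

-- The number is 4(1 + 6t), and the odd factor 1 + 6t exceeds 1.
4+24t≢2^k : ∀ t → 1 ≤ t → ∀ k → 4 + 24 * t ≢ 2 ^ k
4+24t≢2^k t 1≤t zero ()
4+24t≢2^k t 1≤t (suc zero) ()
4+24t≢2^k t 1≤t (suc (suc k)) p = odd-power k (ℕₚ.*-cancelˡ-≡ _ _ 4 (trans (eq t) (trans p (sym (ℕₚ.*-assoc 2 2 (2 ^ k))))))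
  where
  eq : ∀ t → 4 * (1 + 6 * t) ≡ 4 + 24 * t
  eq = solve-∀
  odd-power : ∀ k → 1 + 6 * t ≢ 2 ^ k
  odd-power zero e = contradiction (subst (6 ≤_) (ℕₚ.suc-injective e) (ℕₚ.*-monoʳ-≤ 6 1≤t)) λ ()
  odd-power (suc k) e = 2*≢1+2* (2 ^ k) (3 * t) (trans (sym e) (cong suc (ℕₚ.*-assoc 2 3 t)))

-- As N is odd, a and b have equal parity. Even classes are made of pairs; for odd ones the last
-- hypothesis selects which of the two symmetric sets is used.
split-suc : ∀ {N} (Γ : FinAb N) → let open Balance Γ in
  Odd N → 7 ≤ N → ∀ {a b} → 1 ≤ a → 1 ≤ b → a + b + 1 ≡ N →
  (∃ λ s → s ⊕ s ⊕ s ≢ 0#) ⊎ (Exponent3 Γ × 2 ≤ a × 2 ≤ b) → Split a b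
split-suc {N} Γ oddN 7≤N {a} {b} 1≤a 1≤b tot alt with parity a | parity b
... | inj₁ (i , refl) | inj₁ (j , refl) = split-suc-even Γ oddN i j tot
... | inj₁ (i , refl) | inj₂ (j , refl) = contradiction oddN (even≢odd (1 + i + j , trans (sym tot) (eq i j)))
  where
  eq : ∀ i j → 2 * i + (1 + 2 * j) + 1 ≡ 2 * (1 + i + j)
  eq = solve-∀
... | inj₂ (i , refl) | inj₁ (j , refl) = contradiction oddN (even≢odd (1 + i + j , trans (sym tot) (eq i j)))
  where
  eq : ∀ i j → 1 + 2 * i + 2 * j + 1 ≡ 2 * (1 + i + j)
  eq = solve-∀
... | inj₂ (i , refl) | inj₂ (j , refl) = odd-parts i j tot alt
  where
  open Balance Γ
  3+ : ∀ i → 3 + 2 * i ≡ 1 + 2 * suc i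
  3+ = solve-∀
  odd-parts : ∀ i j → (1 + 2 * i) + (1 + 2 * j) + 1 ≡ N →
    (∃ λ s → s ⊕ s ⊕ s ≢ 0#) ⊎ (Exponent3 Γ × 2 ≤ 1 + 2 * i × 2 ≤ 1 + 2 * j) → Split (1 + 2 * i) (1 + 2 * j)
  odd-parts i (suc j) tot (inj₁ (s , 3s≢0)) = subst (Split _) (3+ j)
    (split-suc-odd Γ oddN 3s≢0 i j (trans (cong (λ b → 1 + 2 * i + b + 1) (3+ j)) tot))
  odd-parts (suc i) zero tot (inj₁ (s , 3s≢0)) = Split-sym (subst (Split _) (3+ i)
    (split-suc-odd Γ oddN 3s≢0 0 i (trans (cong (_+ 1) (trans (cong (1 +_) (3+ i)) (ℕₚ.+-comm 1 (1 + 2 * suc i)))) tot)))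
  -- Classes of size 1 and 1 would mean N = 3.
  odd-parts zero zero tot (inj₁ _) = contradiction (subst (7 ≤_) (sym tot) 7≤N) λ { (s≤s (s≤s (s≤s ()))) }
  odd-parts (suc i) (suc j) tot (inj₂ (exp , _)) = subst (λ a → Split a (1 + 2 * suc j)) (3+ i) (subst (Split (3 + 2 * i)) (3+ j)
    (split-suc-exp3 Γ oddN exp i j (trans (cong₂ (λ a b → a + b + 1) (3+ i) (3+ j)) tot)))
  odd-parts zero _ _ (inj₂ (_ , s≤s () , _))
  odd-parts (suc _) zero _ (inj₂ (_ , _ , s≤s ()))

module _ {n} (G : Graph n) where

  BadStar : Set
  BadStar = ∃ λ q → 1 ≤ q × G ≅ Star-graph (3 ^ (2 * q + 1) ∸ 2)

  -- In exponent 3 the order n + 1 is a power of 3 that is 3 modulo 4, hence an odd power, so a star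
  -- would be one of the excluded ones. Writing `suc k` encodes n ≥ 6.
  goodOrder-n+1 : Connected G → ∀ k → n ≡ 2 + 4 * suc k → ¬ BadStar → GoodOrder G (n + 1)
  goodOrder-n+1 conn k n≡ ¬bad = goodOrder-fromFinAb irregular
    where
    n≥6 : 6 ≤ n
    n≥6 = subst (6 ≤_) (sym n≡) (ℕₚ.+-monoʳ-≤ 2 (ℕₚ.*-monoʳ-≤ 4 (s≤s z≤n)))
    7≤N : 7 ≤ n + 1
    7≤N = ℕₚ.+-monoˡ-≤ 1 n≥6
    oddN : Odd (n + 1)
    oddN = 3 + 2 * k , trans (cong (_+ 1) n≡) (eq k)
      where
      eq : ∀ k → 2 + 4 * suc k + 1 ≡ 1 + 2 * (3 + 2 * k)
      eq = solve-∀
    bad : ∀ {m} (G : Graph m) → m ≡ n → ∀ j → n + 1 ≡ 3 ^ j → IsStar G →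
          ∃ λ q → 1 ≤ q × G ≅ Star-graph (3 ^ (2 * q + 1) ∸ 2)
    bad {suc m} G m≡n j N≡ star =
      let q , 1≤q , j≡ = 3^k≡3+4j⇒k≡2q+1 j (suc k) (trans (sym N≡) (trans (cong (_+ 1) n≡) (eq k))) (s≤s z≤n)
      in q , 1≤q , subst (λ l → G ≅ Star-graph l)
        (trans (cong (_∸ 2) (trans (ℕₚ.+-comm 1 (suc m)) (trans (cong (_+ 1) m≡n) N≡))) (cong (λ j → 3 ^ j ∸ 2) j≡))
        (isStar⇒≅ G star)
      where
      eq : ∀ k → 2 + 4 * suc k + 1 ≡ 3 + 4 * suc k
      eq = solve-∀
    bad {zero} G m≡n j N≡ (() , _)
    irregular : (Γ : FinAb (n + 1)) → Σ (Labelling (FinAb.abelianGroup Γ) G) (Irregular (FinAb.abelianGroup Γ))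
    irregular Γ with any? (λ s → ¬? (FinAb._⊕_ Γ (FinAb._⊕_ Γ s s) s ≟ FinAb.0# Γ))
    ... | yes found =
      let C , 1≤a , 1≤b = colouring-both G (ℕₚ.≤-trans (s≤s (s≤s z≤n)) n≥6) conn in
      Realise.irregular-fromSplit Γ C
        (split-suc Γ oddN 7≤N 1≤a 1≤b (cong (_+ 1) (trues+falses (Colouring.colour C))) (inj₁ found))
    ... | no none = wide (star-or-wide G (ℕₚ.≤-trans (s≤s (s≤s (s≤s (s≤s z≤n)))) n≥6) conn)
      where
      exp : Exponent3 Γ
      exp x = decidable-stable (_ ≟ _) λ 3x≢0 → none (x , 3x≢0)
      wide : IsStar G ⊎ Wide G → _
      wide (inj₁ star) = let j , N≡ = exponent3⇒order Γ exp in contradiction (bad G refl j N≡ star) ¬bad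
      wide (inj₂ (C , 2≤a , 2≤b)) = Realise.irregular-fromSplit Γ C
        (split-suc Γ oddN 7≤N (ℕₚ.<⇒≤ 2≤a) (ℕₚ.<⇒≤ 2≤b) (cong (_+ 1) (trues+falses (Colouring.colour C)))
          (inj₂ (exp , 2≤a , 2≤b)))

  goodOrder-n : Connected G → 3 ≤ n → ¬ (n % 4 ≡ 2) → GoodOrder G n
  goodOrder-n conn 3≤n n%4≢2 = goodOrder-fromFinAb λ Γ →
    let C , 1≤a , 1≤b = colouring-both G (ℕₚ.<⇒≤ 3≤n) conn in
    Realise.irregular-fromSplit Γ C (split Γ 1≤a 1≤b (trues+falses (Colouring.colour C)))
    where
    split : (Γ : FinAb n) → ∀ {a b} → 1 ≤ a → 1 ≤ b → a + b ≡ n → Balance.Split Γ a b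
    split Γ 1≤a 1≤b tot with parity n
    ... | inj₂ oddn = split-odd Γ oddn tot
    ... | inj₁ (i , n≡) with parity i
    ...   | inj₁ (j , i≡) = split-4 Γ j (trans n≡ (trans (cong (2 *_) i≡) (sym (ℕₚ.*-assoc 2 2 j)))) 1≤a 1≤b tot
    ...   | inj₂ (j , i≡) = contradiction
      (trans (cong (_% 4) (trans n≡ (trans (cong (2 *_) i≡) (eq j)))) ([m+kn]%n≡m%n 2 j 4)) n%4≢2
      where
      eq : ∀ j → 2 * (1 + 2 * j) ≡ 2 + j * 4
      eq = solve-∀

  -- The hub alone forms one class and gets weight 0. Here n + 2 = 4 + 24t is no power of 2, which
  -- rules out exponent 2.
  goodOrder-n+2 : ∀ t → 1 ≤ t → n ≡ 2 + 24 * t → IsStar G → GoodOrder G (n + 2)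
  goodOrder-n+2 t 1≤t n≡ (h , hb , _) = goodOrder-fromFinAb λ Γ →
    let C = hub-colouring G hb ; c = Colouring.colour C in
    Realise.irregular-fromSplit Γ C (subst (λ a → Balance.Split Γ a (falses c)) (sym (trues-hub G hb))
      (split-star Γ 5≤N (λ exp2 → let k , N≡ = exponent2⇒order Γ exp2 in 4+24t≢2^k t 1≤t k (trans (sym N≡4+24t) N≡))
        (trans (eq (falses c)) (cong (_+ 2) (trans (cong (_+ falses c) (sym (trues-hub G hb))) (trues+falses c))))))
    where
    eq : ∀ b → b + 3 ≡ 1 + b + 2
    eq = solve-∀
    N≡4+24t : n + 2 ≡ 4 + 24 * t
    N≡4+24t = trans (ℕₚ.+-comm n 2) (cong (2 +_) n≡)
    5≤N : 5 ≤ n + 2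
    5≤N = subst (5 ≤_) (sym N≡4+24t) (ℕₚ.+-monoʳ-≤ 4 (ℕₚ.≤-trans (s≤s z≤n) (ℕₚ.*-monoʳ-≤ 24 1≤t)))

  <+1⇒ : ∀ {s k} → s < k + 1 → s < k ⊎ s ≡ k
  <+1⇒ {s} {k} s<k+1 = ℕₚ.m≤n⇒m<n∨m≡n (ℕₚ.≤-pred (subst (s <_) (ℕₚ.+-comm k 1) s<k+1))

-- The three cases of the formula

theorem1p1 : ∀ (n : ℕ) → 3 ≤ n → (G : Graph n) → Connected G →
    ((∃ λ q → 1 ≤ q × G ≅ Star-graph (3 ^ (2 * q + 1) ∸ 2)) → GroupIrrStrength G (n + 2))
    × (n % 4 ≡ 2 → ¬ (∃ λ q → 1 ≤ q × G ≅ Star-graph (3 ^ (2 * q + 1) ∸ 2)) → GroupIrrStrength G (n + 1))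
    × (¬ (n % 4 ≡ 2) → ¬ (∃ λ q → 1 ≤ q × G ≅ Star-graph (3 ^ (2 * q + 1) ∸ 2)) → GroupIrrStrength G n)
theorem1p1 n 3≤n G conn = bad-star , residue-2 , other
  where
  bad-star : BadStar G → GroupIrrStrength G (n + 2)
  bad-star (q , 1≤q , iso) =
    let t , 3^≡ , 1≤t = 3^[2q+1]≡3+24t q 1≤q
        n≡ : n ≡ 2 + 24 * t
        -- Isomorphic graphs have equal order, so n = 1 + (3 + 24t - 2).
        n≡ = trans (↔⇒≡ (⤖⇒↔ (proj₁ iso))) (cong (λ m → suc (m ∸ 2)) 3^≡)
        star = ≅⇒isStar {G = G} iso
        n+1≡ : suc n ≡ 3 ^ (2 * q + 1)
        n+1≡ = trans (cong suc n≡) (sym 3^≡)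
    in ℕₚ.≤-trans (s≤s z≤n) (ℕₚ.m≤n+m 2 n) , goodOrder-n+2 G t 1≤t n≡ star , λ s 1≤s s<n+2 →
       lower t n≡ star n+1≡ s 1≤s (<+1⇒ G (subst (s <_) (sym (ℕₚ.+-assoc n 1 1)) s<n+2))
    where
    lower : ∀ t → n ≡ 2 + 24 * t → IsStar G → suc n ≡ 3 ^ (2 * q + 1) →
      ∀ s → 1 ≤ s → s < n + 1 ⊎ s ≡ n + 1 → ¬ GoodOrder G s
    -- The order n + 1 fails for the power of ℤ₃ of that order, the order n fails for ℤₙ because n =
    -- 2 + 4(6t), and smaller orders fail by counting.
    lower t n≡ star n+1≡ s 1≤s (inj₂ refl) good = ¬goodOrder-star (2 * q + 1) n+1≡ star
      (subst (GoodOrder G) (trans (ℕₚ.+-comm n 1) n+1≡) good)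
    lower t n≡ star n+1≡ s 1≤s (inj₁ s<n+1) with <+1⇒ G s<n+1
    ... | inj₁ s<n = ¬goodOrder-< 1≤s s<n
    ... | inj₂ refl = ¬goodOrder-≡2 (6 * t) (trans n≡ (cong (2 +_) (ℕₚ.*-assoc 4 6 t)))
  residue-2 : n % 4 ≡ 2 → ¬ BadStar G → GroupIrrStrength G (n + 1)
  residue-2 n%4≡2 ¬bad = ℕₚ.m≤n+m 1 n , good (n / 4) n≡ , lower
    where
    n≡ : n ≡ 2 + 4 * (n / 4)
    n≡ = trans (m≡m%n+[m/n]*n n 4) (cong₂ _+_ n%4≡2 (ℕₚ.*-comm (n / 4) 4))
    good : ∀ k → n ≡ 2 + 4 * k → GoodOrder G (n + 1)
    -- Quotient 0 would mean n = 2, against n ≥ 3.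
    good zero n≡2 = contradiction (subst (3 ≤_) n≡2 3≤n) λ { (s≤s (s≤s ())) }
    good (suc k) n≡ = goodOrder-n+1 G conn k n≡ ¬bad
    lower : ∀ s → 1 ≤ s → s < n + 1 → ¬ GoodOrder G s
    lower s 1≤s s<n+1 with <+1⇒ G s<n+1
    ... | inj₁ s<n = ¬goodOrder-< 1≤s s<n
    ... | inj₂ refl = ¬goodOrder-≡2 (n / 4) n≡
  other : ¬ (n % 4 ≡ 2) → ¬ BadStar G → GroupIrrStrength G n
  other n%4≢2 _ = ℕₚ.≤-trans (s≤s z≤n) 3≤n , goodOrder-n G conn 3≤n n%4≢2 , λ s → ¬goodOrder-<
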